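{- Let $q$ be a prime power and let $f(X)=X^2+bX+c\in\mathbb F_q[X]$ be irreducible. Then $f(X)$ divides $X^{q+1}-c$, and one writes $$H_f(X)=\frac{X^{q+2}-cX}{f(X)}=h_1X^q+h_2X^{q-1}+\cdots+h_qX+h_{q+1},$$ where $h_{q+1}=0$. Let $$r=\min\{2\le i\le q+1:\ h_i=0\}$$ and $\lambda=-c\,h_{r-1}$. Then the binomial order of $f(X)$ is $r$ and the minimal binomial multiple of $f(X)$ is $X^r-\lambda$. Consequently, the order of $f(X)$ is $r\cdot\operatorname{ord}(\lambda)$.
   Context: For $\lambda\in\mathbb F_q^*$, $\operatorname{ord}(\lambda)$ is its multiplicative order. For a nonconstant monic polynomial $f\in\mathbb F_q[X]$ with nonzero constant term, the order of $f$ is the smallest positive integer $n$ such that $f(X)\mid X^n-1$. The minimal binomial multiple of $f$ is the monic binomial $X^r-\lambda\in\mathbb F_q[X]$ (with $\lambda\neq0$) of lowest degree among the binomials over $\mathbb F_q$ divisible by $f$; its degree $r$ is the binomial order of $f$. -}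

module Defs where

open import Algebra.Apartness.Bundles using (HeytingField; HeytingCommutativeRing)
open import Algebra.Bundles using (CommutativeRing; Semiring)
open import Algebra.Bundles.Raw using (RawRing)
import Algebra.Definitions.RawSemiring as RawSemiringDefs
open import Data.Fin.Base using (Fin)
open import Data.List.Base using (List; []; _∷_; map; applyDownFrom)
open import Data.Nat.Base as ℕ using (ℕ; zero; suc; _≤_; _<_)
open import Data.Nat.Primality using (Prime)
open import Data.Product.Base using (_×_; ∃-syntax; ∃₂)
open import Function.Base using (_∘_)
open import Function.Bundles using (Inverse)
open import Level using (Level; _⊔_)
open import Relation.Binary.Core using (Rel)
open import Relation.Binary.PropositionalEquality.Core using (_≡_)
open import Relation.Binary.PropositionalEquality.Properties using (setoid)

IsPrimePower : ℕ → Set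
IsPrimePower q = ∃₂ λ p k → Prime p × 1 ≤ k × q ≡ p ℕ.^ k

IsLeast : ∀ {a : Level} → (ℕ → Set a) → ℕ → Set a
IsLeast P n = P n × (∀ m → P m → n ≤ m)

-- The enumeration by Fin q makes _≈_ and invertibility decidable, so by
-- tightness x # y is equivalent to ¬ (x ≈ y): a Heyting field with this
-- property is the same thing as a field with q elements.
HasCardinality : ∀ {a ℓ₁ ℓ₂ : Level} → HeytingField a ℓ₁ ℓ₂ → ℕ → Set (a ⊔ ℓ₁)
HasCardinality F q = Inverse (setoid (Fin q)) (CommutativeRing.setoid R)
  where R = HeytingCommutativeRing.commutativeRing (HeytingField.heytingCommutativeRing F)

module Polynomial {a ℓ : Level} (R : CommutativeRing a ℓ) where

  open CommutativeRing R
  open RawSemiringDefs (Semiring.rawSemiring semiring) using (_^_)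

  -- Coefficients are listed from the constant term upwards; trailing zeros
  -- are allowed, hence the coefficientwise equality below.
  Poly : Set a
  Poly = List Carrier

  coeff : Poly → ℕ → Carrier
  coeff []      _       = 0#
  coeff (x ∷ p) zero    = x
  coeff (x ∷ p) (suc n) = coeff p n

  infix 4 _≈ₚ_
  _≈ₚ_ : Rel Poly ℓ
  p ≈ₚ s = ∀ n → coeff p n ≈ coeff s n

  infixl 6 _+ₚ_ _-ₚ_
  infixl 7 _*ₚ_

  _+ₚ_ : Poly → Poly → Poly
  []      +ₚ s       = s
  (x ∷ p) +ₚ []      = x ∷ p
  (x ∷ p) +ₚ (y ∷ s) = (x + y) ∷ (p +ₚ s)

  _*ₚ_ : Poly → Poly → Poly
  []      *ₚ s = []
  (x ∷ p) *ₚ s = map (x *_) s +ₚ (0# ∷ p *ₚ s)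

  -ₚ_ : Poly → Poly
  -ₚ_ = map (-_)

  _-ₚ_ : Poly → Poly → Poly
  p -ₚ s = p +ₚ (-ₚ s)

  C : Carrier → Poly
  C x = x ∷ []

  X : Poly
  X = 0# ∷ 1# ∷ []

  polyRawRing : RawRing a ℓ
  polyRawRing = record
    { Carrier = Poly
    ; _≈_     = _≈ₚ_
    ; _+_     = _+ₚ_
    ; _*_     = _*ₚ_
    ; -_      = -ₚ_
    ; 0#      = []
    ; 1#      = C 1#
    }

  open RawSemiringDefs (RawRing.rawSemiring polyRawRing) public
    using (Irreducible)
    renaming (_^_ to _^ₚ_; _∣_ to _∣ₚ_)

  -- h₁ X^(n-1) + h₂ X^(n-2) + ⋯ + hₙ; the value h 0 is never used.
  descending : (ℕ → Carrier) → ℕ → Poly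
  descending h n = applyDownFrom (h ∘ suc) n

  IsMultiplicativeOrder : Carrier → ℕ → Set ℓ
  IsMultiplicativeOrder x = IsLeast λ n → 0 < n × x ^ n ≈ 1#

  IsPolynomialOrder : Poly → ℕ → Set (a ⊔ ℓ)
  IsPolynomialOrder f = IsLeast λ n → 0 < n × f ∣ₚ (X ^ₚ n -ₚ C 1#)

  -- Binomials of degree n are taken in the general sense, x Xⁿ + y Xᵐ with
  -- m < n and both coefficients nonzero.
  IsBinomialOfDegree : Poly → ℕ → Set (a ⊔ ℓ)
  IsBinomialOfDegree g n =
    ∃[ x ] ∃[ y ] ∃[ m ] (x ≉ 0# × y ≉ 0# × m < n ×
      g ≈ₚ C x *ₚ X ^ₚ n +ₚ C y *ₚ X ^ₚ m)

  -- The minimal binomial multiple of f is X^r - μ.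
  record IsMinimalBinomialMultiple (f : Poly) (r : ℕ) (μ : Carrier) : Set (a ⊔ ℓ) where
    field
      r>0     : 0 < r
      μ≉0     : μ ≉ 0#
      divides : f ∣ₚ (X ^ₚ r -ₚ C μ)
      minimal : ∀ g n → IsBinomialOfDegree g n → f ∣ₚ g → r ≤ n

  IsBinomialOrder : Poly → ℕ → Set (a ⊔ ℓ)
  IsBinomialOrder f r = ∃[ μ ] IsMinimalBinomialMultiple f r μ

module Submission where

-- Let K = F[α] with α² = -bα - c, so that f(α) = 0 in K. Writing
-- αⁿ = sₙ α - c sₙ₋₁, the sequence s satisfies s₁ = 1 and
-- sₙ₊₂ = -b sₙ₊₁ - c sₙ, and X^(n+1) = f · (s₁ X^(n-1) + ⋯ + sₙ) + sₙ₊₁ X - c sₙ.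
-- Hence f divides Xⁿ - μ iff αⁿ = μ, a power αⁿ lies in F iff sₙ = 0, and hᵢ = sᵢ
-- once α^(q+1) = c is known. For the latter, α (a + α) = (a - b) (-c/(a - b) + α)
-- for a ≠ b, and α (b + α) = -c; taking the product over all a in F and cancelling
-- the factors a + α gives α^(q+1) = -c ∏_{x ≠ 0} x, which is c by Wilson's theorem.

open import Defs
open import Algebra.Apartness.Bundles using (HeytingField; HeytingCommutativeRing)
import Algebra.Apartness.Properties.HeytingCommutativeRing as HeytingCommutativeRingProperties
open import Algebra.Bundles using (CommutativeMonoid; CommutativeRing; CommutativeSemiring)
import Algebra.Construct.DirectProduct as DirectProduct
open import Algebra.Definitions using (RightInvertible)
open import Algebra.Definitions.RawMagma using (module _∣ʳ_)
open import Algebra.Definitions.RawSemiring using (module Irreducible)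
import Algebra.Properties.CommutativeMonoid.Sum as Sum
import Algebra.Properties.CommutativeSemigroup as CommutativeSemigroupProperties
import Algebra.Properties.Ring as RingProperties
import Algebra.Properties.Semiring.Exp as Exp
import Algebra.Solver.Ring.NaturalCoefficients.Default as SemiringSolver
open import Algebra.Structures.Biased using (isCommutativeSemiringˡ)
open import Data.Fin.Base using (Fin; zero; suc; punchIn)
import Data.Fin.Permutation as Permutation
import Data.Fin.Properties as Fin
open import Data.List.Base using ([]; _∷_; map)
open import Data.Nat.Base as ℕ using (ℕ; zero; suc; _≤_; _<_; _∸_; z≤n; s≤s)
open import Data.Nat.DivMod using (_/_; _%_; m≡m%n+[m/n]*n; m%n<n)
open import Data.Nat.Induction using (<-rec)
import Data.Nat.Properties as ℕ
open import Data.Product.Base using (_×_; _,_; proj₁; proj₂; ∃; ∃-syntax)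
open import Data.Sum.Base using ([_,_]′)
open import Data.Vec.Functional using (removeAt)
open import Function.Base using (_∘_)
open import Function.Bundles using (Inverse)
open import Level using (Level; _⊔_)
open import Relation.Binary.PropositionalEquality.Core as ≡ using (_≡_; _≢_)
import Relation.Binary.Reasoning.Setoid as SetoidReasoning
open import Relation.Nullary.Decidable.Core as Dec using (Dec; yes; no; _×-dec_)
open import Relation.Nullary.Negation.Core using (¬_; contradiction)

-- The equality α^(q+1) = c is usually read off from the Frobenius conjugate of α; here it comes
-- from counting points. Multiplication by α moves the q + 1 points a + α (a in F) and 1 of the
-- projective line over F, and each point contributes one factor α. The two exceptional images fit
-- together: α · 1 = 0 + α supplies the value 0 that a ↦ -c/(a - b) misses, and α (b + α) = -c lands
-- on the point 1. Completed by b ↦ 0, this map is a permutation of F, so the product of the a + α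
-- is the same before and after, and only the scalars remain. K is never shown to be a field.
-- Cancellation is applied only to products of nonzero elements of F and of elements a + α, and the
-- latter are units because (a + α)(b - a + α) = -f(-a), which is nonzero when f is irreducible.

-- Products differing in one factor, and the quadratic extension.

module _ {a ℓ : Level} (M : CommutativeMonoid a ℓ) where

  open CommutativeMonoid M
  open Sum M
  open SetoidReasoning setoid

  -- Both sides are `s j ∙ t j` times the common product of the other factors. This compares two
  -- products that differ in one place without any cancellation.
  sum-exchange : ∀ {n} (s t : Fin n → Carrier) (j : Fin n) →
                 (∀ i → i ≢ j → s i ≈ t i) → s j ∙ sum t ≈ t j ∙ sum s
  sum-exchange {suc n} s t j s≈t = begin
    s j ∙ sum t                      ≈⟨ ∙-congˡ (sum-remove {i = j} t) ⟩
    s j ∙ (t j ∙ sum (removeAt t j)) ≈⟨ x∙yz≈y∙xz _ _ _ ⟩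
    t j ∙ (s j ∙ sum (removeAt t j)) ≈⟨ ∙-congˡ (∙-congˡ (sum-cong-≋ λ i → s≈t (punchIn j i) (Fin.punchInᵢ≢i j i))) ⟨
    t j ∙ (s j ∙ sum (removeAt s j)) ≈⟨ ∙-congˡ (sum-remove {i = j} s) ⟨
    t j ∙ sum s                      ∎
    where open CommutativeSemigroupProperties commutativeSemigroup using (x∙yz≈y∙xz)

-- The quadratic extension S[α] with α² = β α + γ; the pair (u , v) stands for
-- u + v α.
module QuadraticExtension {a ℓ : Level} (S : CommutativeSemiring a ℓ)
  (β γ : CommutativeSemiring.Carrier S) where

  private module S = CommutativeSemiring S
  open S using (_+_; _*_; 0#; 1#)
  open SemiringSolver S

  infixl 7 _⊛_
  _⊛_ : S.Carrier × S.Carrier → S.Carrier × S.Carrier → S.Carrier × S.Carrier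
  (u , v) ⊛ (u′ , v′) = u * u′ + γ * (v * v′) , u * v′ + v * u′ + β * (v * v′)

  -- The rule α² = β α + γ involves no subtraction, so a semiring suffices as base: every law
  -- becomes a semiring identity in the coordinates, and powers, products and the solver are then
  -- available in the extension too.
  extension : CommutativeSemiring a ℓ
  extension = record
    { _*_ = _⊛_
    ; 1#  = 1# , 0#
    ; isCommutativeSemiring = isCommutativeSemiringˡ record
      { +-isCommutativeMonoid = CommutativeMonoid.isCommutativeMonoid
          (DirectProduct.commutativeMonoid S.+-commutativeMonoid S.+-commutativeMonoid)
      ; *-isCommutativeMonoid = record
        { isMonoid = record
          { isSemigroup = record
            { isMagma = record
              { isEquivalence = CommutativeMonoid.isEquivalence
                  (DirectProduct.commutativeMonoid S.+-commutativeMonoid S.+-commutativeMonoid)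
              ; ∙-cong = λ (p , p′) (r , r′) →
                    S.+-cong (S.*-cong p r) (S.*-congˡ (S.*-cong p′ r′))
                  , S.+-cong (S.+-cong (S.*-cong p r′) (S.*-cong p′ r)) (S.*-congˡ (S.*-cong p′ r′))
              }
            ; assoc = λ (u , u′) (v , v′) (w , w′) →
                  solve 8 (λ u u′ v v′ w w′ β γ →
                    (u :* v :+ γ :* (u′ :* v′)) :* w :+ γ :* ((u :* v′ :+ u′ :* v :+ β :* (u′ :* v′)) :* w′)
                    := u :* (v :* w :+ γ :* (v′ :* w′)) :+ γ :* (u′ :* (v :* w′ :+ v′ :* w :+ β :* (v′ :* w′))))
                    S.refl u u′ v v′ w w′ β γ
                , solve 8 (λ u u′ v v′ w w′ β γ →
                    (u :* v :+ γ :* (u′ :* v′)) :* w′ :+ (u :* v′ :+ u′ :* v :+ β :* (u′ :* v′)) :* w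
                      :+ β :* ((u :* v′ :+ u′ :* v :+ β :* (u′ :* v′)) :* w′)
                    := u :* (v :* w′ :+ v′ :* w :+ β :* (v′ :* w′)) :+ u′ :* (v :* w :+ γ :* (v′ :* w′))
                      :+ β :* (u′ :* (v :* w′ :+ v′ :* w :+ β :* (v′ :* w′))))
                    S.refl u u′ v v′ w w′ β γ
            }
          ; identity = (λ (u , v) →
                solve 3 (λ u v γ → con 1 :* u :+ γ :* (con 0 :* v) := u) S.refl u v γ
              , solve 3 (λ u v β → con 1 :* v :+ con 0 :* u :+ β :* (con 0 :* v) := v) S.refl u v β)
            , (λ (u , v) →
                solve 3 (λ u v γ → u :* con 1 :+ γ :* (v :* con 0) := u) S.refl u v γ
              , solve 3 (λ u v β → u :* con 0 :+ v :* con 1 :+ β :* (v :* con 0) := v) S.refl u v β)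
          }
        ; comm = λ (u , u′) (v , v′) →
              solve 5 (λ u u′ v v′ γ → u :* v :+ γ :* (u′ :* v′) := v :* u :+ γ :* (v′ :* u′)) S.refl u u′ v v′ γ
            , solve 5 (λ u u′ v v′ β → u :* v′ :+ u′ :* v :+ β :* (u′ :* v′)
                                    := v :* u′ :+ v′ :* u :+ β :* (v′ :* u′)) S.refl u u′ v v′ β
        }
      ; distribʳ = λ (w , w′) (u , u′) (v , v′) →
            solve 7 (λ u u′ v v′ w w′ γ →
              (u :+ v) :* w :+ γ :* ((u′ :+ v′) :* w′)
              := u :* w :+ γ :* (u′ :* w′) :+ (v :* w :+ γ :* (v′ :* w′)))
              S.refl u u′ v v′ w w′ γ
          , solve 7 (λ u u′ v v′ w w′ β →
              (u :+ v) :* w′ :+ (u′ :+ v′) :* w :+ β :* ((u′ :+ v′) :* w′)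
              := u :* w′ :+ u′ :* w :+ β :* (u′ :* w′) :+ (v :* w′ :+ v′ :* w :+ β :* (v′ :* w′)))
              S.refl u u′ v v′ w w′ β
      ; zeroˡ = λ (u , v) →
            solve 3 (λ u v γ → con 0 :* u :+ γ :* (con 0 :* v) := con 0) S.refl u v γ
          , solve 3 (λ u v β → con 0 :* v :+ con 0 :* u :+ β :* (con 0 :* v) := con 0) S.refl u v β
      }
    }

  private module K = CommutativeSemiring extension

  ι : S.Carrier → K.Carrier
  ι x = x , 0#

  α : K.Carrier
  α = 0# , 1#

  ι-cong : ∀ {x y} → x S.≈ y → ι x K.≈ ι y
  ι-cong x≈y = x≈y , S.refl

  ι-homo-+ : ∀ x y → ι (x + y) K.≈ ι x K.+ ι y
  ι-homo-+ x y = S.refl , S.sym (S.+-identityˡ 0#)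

  ι-*ˡ : ∀ x u v → ι x ⊛ (u , v) K.≈ (x * u , x * v)
  ι-*ˡ x u v = solve 4 (λ x u v γ → x :* u :+ γ :* (con 0 :* v) := x :* u) S.refl x u v γ
             , solve 4 (λ x u v β → x :* v :+ con 0 :* u :+ β :* (con 0 :* v) := x :* v) S.refl x u v β

  ι-homo-* : ∀ x y → ι (x * y) K.≈ ι x ⊛ ι y
  ι-homo-* x y = K.sym (K.trans (ι-*ˡ x y 0#) (S.refl , S.zeroʳ x))

  α-* : ∀ u v → α ⊛ (u , v) K.≈ (γ * v , u + β * v)
  α-* u v = solve 3 (λ u v γ → con 0 :* u :+ γ :* (con 1 :* v) := γ :* v) S.refl u v γ
          , solve 3 (λ u v β → con 0 :* v :+ con 1 :* u :+ β :* (con 1 :* v) := u :+ β :* v) S.refl u v β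

  open Exp S.semiring using () renaming (_^_ to _^ˢ_)
  open Exp K.semiring using (_^_)
  open Sum S.*-commutativeMonoid using () renaming (sum to ∏ˢ)
  open Sum K.*-commutativeMonoid using () renaming (sum to ∏)

  ι-homo-^ : ∀ x n → ι (x ^ˢ n) K.≈ ι x ^ n
  ι-homo-^ x zero    = K.refl
  ι-homo-^ x (suc n) = K.trans (ι-homo-* x (x ^ˢ n)) (K.*-congˡ (ι-homo-^ x n))

  ι-homo-∏ : ∀ {n} (t : Fin n → S.Carrier) → ι (∏ˢ t) K.≈ ∏ (ι ∘ t)
  ι-homo-∏ {zero}  t = K.refl
  ι-homo-∏ {suc n} t = K.trans (ι-homo-* _ _) (K.*-congˡ (ι-homo-∏ (t ∘ suc)))

  -- A Lucas sequence. The expansion of powers starts at α^1, since writing α^0 as (γ s₋₁ , s₀)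
  -- would require s₋₁ = 1/γ.
  α-coefficient : ℕ → S.Carrier
  α-coefficient 0             = 0#
  α-coefficient 1             = 1#
  α-coefficient (suc (suc n)) = γ * α-coefficient n + β * α-coefficient (suc n)

  α^[1+n] : ∀ n → α ^ suc n K.≈ (γ * α-coefficient n , α-coefficient (suc n))
  α^[1+n] zero    = K.trans (K.*-identityʳ α) (S.sym (S.zeroʳ γ) , S.refl)
  α^[1+n] (suc n) = K.trans (K.*-congˡ {α} (α^[1+n] n)) (α-* _ _)

  -- Multiplication by α permutes the points e + α and 1 of the projective line
  -- up to scalars: α (e + α) = t (σ + α) with t = e + β and σ = γ / t, except
  -- that α (e + α) = γ when e + β = 0, where we put t = 1 and σ = 0.
  α^[1+n]*∏ : ∀ {n} (e t σ : Fin n → S.Carrier) (j : Fin n) →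
              e j + β S.≈ 0# → t j S.≈ 1# → σ j S.≈ 0# →
              (∀ i → i ≢ j → t i S.≈ e i + β) → (∀ i → i ≢ j → t i * σ i S.≈ γ) →
              α ^ suc n ⊛ ∏ (λ i → e i , 1#) K.≈ ι γ ⊛ (ι (∏ˢ t) ⊛ ∏ (λ i → σ i , 1#))
  α^[1+n]*∏ {n} e t σ j e[j]+β≈0 t[j]≈1 σ[j]≈0 t≈e+β tσ≈γ = begin
    α ^ suc n ⊛ ∏ P             ≈⟨ K.*-assoc α (α ^ n) (∏ P) ⟩
    α ⊛ (α ^ n ⊛ ∏ P)           ≈⟨ K.*-congˡ {α} (K.trans (∑-distrib-+ (λ _ → α) P) (K.*-congʳ {∏ P} (sum-replicate n))) ⟨
    -- Of the n + 1 factors α, n went to the points e i + α. The remaining one is α · 1, the image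
    -- of the point at infinity, and it takes the vacant place j on the right.
    α ⊛ ∏ L                     ≈⟨ K.*-congʳ {∏ L} R[j]≈α ⟨
    R j ⊛ ∏ L                   ≈⟨ sum-exchange K.*-commutativeMonoid L R j L≈R ⟨
    L j ⊛ ∏ R                   ≈⟨ K.*-cong (K.trans (L≈ j) (S.refl , e[j]+β≈0))
                                     (K.trans (∑-distrib-+ (ι ∘ t) Q) (K.*-congʳ {∏ Q} (K.sym (ι-homo-∏ t)))) ⟩
    ι γ ⊛ (ι (∏ˢ t) ⊛ ∏ Q)      ∎
    where
    open SetoidReasoning K.setoid
    open Sum K.*-commutativeMonoid using (∑-distrib-+; sum-replicate)
    P Q L R : Fin n → K.Carrier
    P i = e i , 1#
    Q i = σ i , 1#
    L i = α ⊛ P i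
    R i = ι (t i) ⊛ Q i
    L≈ : ∀ i → L i K.≈ (γ , e i + β)
    L≈ i = K.trans (α-* (e i) 1#) (S.*-identityʳ γ , S.+-congˡ (S.*-identityʳ β))
    R≈ : ∀ i → R i K.≈ (t i * σ i , t i)
    R≈ i = K.trans (ι-*ˡ (t i) (σ i) 1#) (S.refl , S.*-identityʳ (t i))
    L≈R : ∀ i → i ≢ j → L i K.≈ R i
    L≈R i i≢j = K.trans (L≈ i) (K.sym (K.trans (R≈ i) (tσ≈γ i i≢j , t≈e+β i i≢j)))
    R[j]≈α : R j K.≈ α
    R[j]≈α = K.trans (R≈ j) (S.trans (S.*-congˡ σ[j]≈0) (S.zeroʳ (t j)) , t[j]≈1)

-- Units of a commutative monoid and cancellation.

module InvertibleElements {a ℓ : Level} (M : CommutativeMonoid a ℓ) where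

  open CommutativeMonoid M
  open Sum M
  open SetoidReasoning setoid

  Invertible : Carrier → Set (a ⊔ ℓ)
  Invertible = RightInvertible _≈_ ε _∙_

  invertible-∙ : ∀ {x y} → Invertible x → Invertible y → Invertible (x ∙ y)
  invertible-∙ {x} {y} (x′ , xx′≈ε) (y′ , yy′≈ε) = x′ ∙ y′ , (begin
    (x ∙ y) ∙ (x′ ∙ y′) ≈⟨ interchange x y x′ y′ ⟩
    (x ∙ x′) ∙ (y ∙ y′) ≈⟨ ∙-cong xx′≈ε yy′≈ε ⟩
    ε ∙ ε               ≈⟨ identityˡ ε ⟩
    ε                   ∎)
    where open CommutativeSemigroupProperties commutativeSemigroup using (interchange)

  invertible-sum : ∀ {n} (t : Fin n → Carrier) → (∀ i → Invertible (t i)) → Invertible (sum t)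
  invertible-sum {zero}  t u = ε , identityˡ ε
  invertible-sum {suc n} t u = invertible-∙ (u zero) (invertible-sum (t ∘ suc) (u ∘ suc))

  cancelʳ : ∀ {x} → Invertible x → ∀ y z → y ∙ x ≈ z ∙ x → y ≈ z
  cancelʳ {x} (x′ , xx′≈ε) y z yx≈zx = begin
    y            ≈⟨ strip y ⟨
    (y ∙ x) ∙ x′ ≈⟨ ∙-congʳ yx≈zx ⟩
    (z ∙ x) ∙ x′ ≈⟨ strip z ⟩
    z            ∎
    where
    strip : ∀ w → (w ∙ x) ∙ x′ ≈ w
    strip w = trans (assoc w x x′) (trans (∙-congˡ xx′≈ε) (identityʳ w))

-- Monic polynomial functions and their roots.

module MonicFunctions {a ℓ : Level} (R : CommutativeRing a ℓ) where

  open CommutativeRing R hiding (zero)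
  open RingProperties ring using (x∙y⁻¹≈ε⇒x≈y)
  open Exp semiring using (_^_)
  open Sum *-commutativeMonoid using () renaming (sum to ∏)
  open SemiringSolver commutativeSemiring
  open SetoidReasoning setoid

  -- g is the function of a monic polynomial of degree n, in Horner form.
  Monic : ℕ → (Carrier → Carrier) → Set (a ⊔ ℓ)
  Monic zero    g = ∀ t → g t ≈ 1#
  Monic (suc n) g = ∃[ x ] ∃[ h ] Monic n h × (∀ t → g t ≈ x + t * h t)

  monic-^ : ∀ n → Monic n (_^ n)
  monic-^ zero    = λ _ → refl
  monic-^ (suc n) = 0# , _ , monic-^ n , λ _ → sym (+-identityˡ _)

  -- Synthetic division: if h t = h r + (t - r) k t, then x + t h t has remainder g r and quotient h
  -- r + t k t, which is again in Horner form.
  divide-linear : ∀ n {g} → Monic (suc n) g → ∀ r →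
                  ∃[ h ] Monic n h × (∀ t → g t ≈ g r + (t - r) * h t)
  divide-linear n {g} (x , h , monic-h , g≈) r = quotient n monic-h
    where
    -- The semiring solver knows no subtraction; t - r is treated as an indeterminate and t is
    -- replaced by r plus it.
    t≈r+[t-r] : ∀ t → t ≈ r + (t - r)
    t≈r+[t-r] t = begin
      t             ≈⟨ +-identityʳ t ⟨
      t + 0#        ≈⟨ +-congˡ (-‿inverseˡ r) ⟨
      t + (- r + r) ≈⟨ solve 3 (λ t r s → t :+ (s :+ r) := r :+ (t :+ s)) refl t r (- r) ⟩
      r + (t - r)   ∎
    quotient : ∀ n → Monic n h → ∃[ h′ ] Monic n h′ × (∀ t → g t ≈ g r + (t - r) * h′ t)
    quotient zero h≈1 = (λ _ → 1#) , (λ _ → refl) , λ t → begin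
      g t                     ≈⟨ g≈ t ⟩
      x + t * h t             ≈⟨ +-congˡ (*-cong (t≈r+[t-r] t) (h≈1 t)) ⟩
      x + (r + (t - r)) * 1#  ≈⟨ solve 3 (λ x r s → x :+ (r :+ s) :* con 1 := (x :+ r :* con 1) :+ s :* con 1) refl x r (t - r) ⟩
      x + r * 1# + (t - r) * 1# ≈⟨ +-congʳ (trans (g≈ r) (+-congˡ (*-congˡ (h≈1 r)))) ⟨
      g r + (t - r) * 1#      ∎
    quotient (suc n) monic-h with divide-linear n monic-h r
    ... | k , monic-k , h≈ = (λ t → h r + t * k t) , (h r , k , monic-k , λ _ → refl) , λ t → begin
      g t                                    ≈⟨ g≈ t ⟩
      x + t * h t                            ≈⟨ +-congˡ (*-congˡ (h≈ t)) ⟩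
      x + t * (h r + (t - r) * k t)          ≈⟨ solve 5 (λ x t u s v → x :+ t :* (u :+ s :* v) := x :+ t :* u :+ s :* (t :* v)) refl x t (h r) (t - r) (k t) ⟩
      x + t * h r + (t - r) * (t * k t)      ≈⟨ +-congʳ (+-congˡ (*-congʳ (t≈r+[t-r] t))) ⟩
      x + (r + (t - r)) * h r + (t - r) * (t * k t)
        ≈⟨ solve 5 (λ x r u s v → x :+ (r :+ s) :* u :+ s :* v := (x :+ r :* u) :+ s :* (u :+ v)) refl x r (h r) (t - r) (t * k t) ⟩
      x + r * h r + (t - r) * (h r + t * k t) ≈⟨ +-congʳ (g≈ r) ⟨
      g r + (t - r) * (h r + t * k t)        ∎

  -- Dividing by t - `e zero` keeps the other roots, because by injectivity that factor does not
  -- vanish at them. After n divisions only the constant 1 is left.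
  monic-roots : (∀ {x y} → ¬ x ≈ 0# → x * y ≈ 0# → y ≈ 0#) →
                ∀ n {g} → Monic n g → (e : Fin n → Carrier) →
                (∀ {i j} → e i ≈ e j → i ≡ j) → (∀ i → g (e i) ≈ 0#) →
                ∀ t → g t ≈ ∏ (λ i → t - e i)
  monic-roots integral zero    monic-g e e-injective g[e]≈0 t = monic-g t
  monic-roots integral (suc n) {g} monic-g e e-injective g[e]≈0 t
    with divide-linear n monic-g (e zero)
  ... | h , monic-h , g≈ = trans (g-factors t) (*-congˡ
      (monic-roots integral n monic-h (e ∘ suc) (Fin.suc-injective ∘ e-injective) h[e]≈0 t))
    where
    g-factors : ∀ t → g t ≈ (t - e zero) * h t
    g-factors t = trans (g≈ t) (trans (+-congʳ (g[e]≈0 zero)) (+-identityˡ _))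
    h[e]≈0 : ∀ i → h (e (suc i)) ≈ 0#
    h[e]≈0 i = integral
      (λ eq → contradiction (e-injective (x∙y⁻¹≈ε⇒x≈y _ _ eq)) λ ())
      (trans (sym (g-factors (e (suc i)))) (g[e]≈0 (suc i)))

-- Finite fields: inverses, reindexing, Fermat and Wilson.

nontrivial : ∀ {a ℓ₁ ℓ₂ : Level} (F : HeytingField a ℓ₁ ℓ₂) → let open HeytingField F in ¬ 1# ≈ 0#
nontrivial F 1≈0 = proj₂ (tight 1# 0#) 1≈0 1#0
  where
  open HeytingField F
  open HeytingCommutativeRingProperties heytingCommutativeRing using (1#0)

cardinality≥2 : ∀ {a ℓ₁ ℓ₂ : Level} (F : HeytingField a ℓ₁ ℓ₂) q → HasCardinality F q → 2 ≤ q
cardinality≥2 F zero card with Inverse.from card (HeytingField.0# F)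
... | ()
cardinality≥2 F (suc (suc k)) card = s≤s (s≤s z≤n)
cardinality≥2 F (suc zero) card = contradiction 1≈0 (nontrivial F)
  where
  open HeytingField F
  open Inverse card using (to; from; strictlyInverseˡ)
  Fin1-unique : (i j : Fin 1) → i ≡ j
  Fin1-unique zero zero = ≡.refl
  1≈0 : 1# ≈ 0#
  1≈0 = trans (sym (strictlyInverseˡ 1#))
    (trans (reflexive (≡.cong to (Fin1-unique (from 1#) (from 0#)))) (strictlyInverseˡ 0#))

module FiniteField {a ℓ₁ ℓ₂ : Level} (F : HeytingField a ℓ₁ ℓ₂) (q : ℕ)
  (card : HasCardinality F q) where

  private
    HCR = HeytingField.heytingCommutativeRing F
    R = HeytingCommutativeRing.commutativeRing HCR

  open HeytingField F using (tight; #⇒invertible)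
  open CommutativeRing R hiding (zero)
  open RingProperties ring
  open Exp semiring using (_^_)
  open Sum *-commutativeMonoid
    using (sum-replicate; ∑-distrib-+) renaming (sum to ∏)
  open InvertibleElements *-commutativeMonoid
  open SetoidReasoning setoid
  open Inverse card public using () renaming (to to enum; from to index; from-cong to index-cong)

  enum-index : ∀ x → enum (index x) ≈ x
  enum-index = Inverse.strictlyInverseˡ card

  index-enum : ∀ i → index (enum i) ≡ i
  index-enum = Inverse.strictlyInverseʳ card

  enum-injective : ∀ {i j} → enum i ≈ enum j → i ≡ j
  enum-injective {i} {j} eq = ≡.trans (≡.sym (index-enum i)) (≡.trans (index-cong eq) (index-enum j))

  infix 4 _≟_
  _≟_ : ∀ x y → Dec (x ≈ y)
  x ≟ y = Dec.map′
    (λ eq → trans (sym (enum-index x)) (trans (reflexive (≡.cong enum eq)) (enum-index y)))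
    index-cong (index x Fin.≟ index y)

  1≉0 : 1# ≉ 0#
  1≉0 = nontrivial F

  -- Tightness only refutes the absence of an inverse; the enumeration finds one.
  invertible : ∀ {x} → x ≉ 0# → Invertible x
  invertible {x} x≉0 with Fin.any? (λ i → x * enum i ≟ 1#)
  ... | yes (i , xy≈1) = enum i , xy≈1
  ... | no  none       = contradiction (proj₁ (tight x 0#) ¬x#0) x≉0
    where
    ¬x#0 : ¬ (HeytingField._#_ F x 0#)
    ¬x#0 x#0 with #⇒invertible x#0
    ... | y , _ , [x-0]y≈1 = none (index y , (begin
      x * enum (index y) ≈⟨ *-cong (sym (trans (+-congˡ -0#≈0#) (+-identityʳ x))) (enum-index y) ⟩
      (x - 0#) * y       ≈⟨ [x-0]y≈1 ⟩
      1#                 ∎))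

  *-cancelʳ-≉0 : ∀ {x} → x ≉ 0# → ∀ y z → y * x ≈ z * x → y ≈ z
  *-cancelʳ-≉0 x≉0 = cancelʳ (invertible x≉0)

  integral : ∀ {x y} → x ≉ 0# → x * y ≈ 0# → y ≈ 0#
  integral {x} {y} x≉0 xy≈0 =
    *-cancelʳ-≉0 x≉0 y 0# (trans (*-comm y x) (trans xy≈0 (sym (zeroˡ x))))

  -- With the value 0 at 0, inversion is an involution of the whole field and can reindex products
  -- over all of F.
  inv : Carrier → Carrier
  inv x with x ≟ 0#
  ... | yes _   = 0#
  ... | no  x≉0 = proj₁ (invertible x≉0)

  inv-zero : ∀ {x} → x ≈ 0# → inv x ≈ 0#
  inv-zero {x} x≈0 with x ≟ 0#
  ... | yes _   = refl
  ... | no  x≉0 = contradiction x≈0 x≉0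

  inv-inverse : ∀ {x} → x ≉ 0# → x * inv x ≈ 1#
  inv-inverse {x} x≉0 with x ≟ 0#
  ... | yes x≈0  = contradiction x≈0 x≉0
  ... | no  x≉0′ = proj₂ (invertible x≉0′)

  inv-unique : ∀ {x y} → x * y ≈ 1# → inv x ≈ y
  inv-unique {x} {y} xy≈1 = *-cancelʳ-≉0 x≉0 (inv x) y (begin
    inv x * x ≈⟨ *-comm _ _ ⟩
    x * inv x ≈⟨ inv-inverse x≉0 ⟩
    1#        ≈⟨ xy≈1 ⟨
    x * y     ≈⟨ *-comm _ _ ⟩
    y * x     ∎)
    where
    x≉0 : x ≉ 0#
    x≉0 x≈0 = 1≉0 (trans (sym xy≈1) (trans (*-congʳ x≈0) (zeroˡ y)))

  inv-cong : ∀ {x y} → x ≈ y → inv x ≈ inv y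
  inv-cong {x} {y} x≈y with y ≟ 0#
  ... | yes y≈0 = inv-zero (trans x≈y y≈0)
  ... | no  y≉0 = inv-unique (trans (*-congʳ x≈y) (proj₂ (invertible y≉0)))

  inv-involutive : ∀ x → inv (inv x) ≈ x
  inv-involutive x with x ≟ 0#
  ... | yes x≈0 = trans (inv-zero refl) (sym x≈0)
  ... | no  x≉0 = inv-unique (trans (*-comm _ _) (proj₂ (invertible x≉0)))

  module _ {m ℓ : Level} (M : CommutativeMonoid m ℓ) where

    private module M = CommutativeMonoid M
    open Sum M using (sum; sum-permute) renaming (sum-cong-≋ to sumᴹ-cong)

    -- Conjugation by the enumeration turns a bijection of the field into a permutation of `Fin q`.
    -- The monoid is arbitrary because products are reindexed both in F and in its extension.
    sum-bijection : (g : Carrier → M.Carrier) → (∀ {x y} → x ≈ y → g x M.≈ g y) →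
                    (σ τ : Carrier → Carrier) →
                    (∀ {x y} → x ≈ y → σ x ≈ σ y) → (∀ {x y} → x ≈ y → τ x ≈ τ y) →
                    (∀ x → σ (τ x) ≈ x) → (∀ x → τ (σ x) ≈ x) →
                    sum (g ∘ enum) M.≈ sum (g ∘ σ ∘ enum)
    sum-bijection g g-cong σ τ σ-cong τ-cong σ∘τ τ∘σ = M.trans
      (sum-permute (g ∘ enum) π)
      (sumᴹ-cong λ i → g-cong (enum-index (σ (enum i))))
      where
      conjugate : (Carrier → Carrier) → Fin q → Fin q
      conjugate σ = index ∘ σ ∘ enum
      conjugate-inverse : ∀ {σ τ} → (∀ {x y} → x ≈ y → σ x ≈ σ y) → (∀ x → σ (τ x) ≈ x) →
                          ∀ i → conjugate σ (conjugate τ i) ≡ i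
      conjugate-inverse σ-cong σ∘τ i = ≡.trans
        (index-cong (trans (σ-cong (enum-index _)) (σ∘τ (enum i)))) (index-enum i)
      π = Permutation.permutation (conjugate σ) (conjugate τ)
            (conjugate-inverse σ-cong σ∘τ) (conjugate-inverse τ-cong τ∘σ)

  -- w replaces 0 by 1, so that ∏ w runs over the nonzero elements.
  w : Carrier → Carrier
  w x with x ≟ 0#
  ... | yes _ = 1#
  ... | no  _ = x

  w-zero : ∀ {x} → x ≈ 0# → w x ≈ 1#
  w-zero {x} x≈0 with x ≟ 0#
  ... | yes _   = refl
  ... | no  x≉0 = contradiction x≈0 x≉0

  w-nonzero : ∀ {x} → x ≉ 0# → w x ≈ x
  w-nonzero {x} x≉0 with x ≟ 0#
  ... | yes x≈0 = contradiction x≈0 x≉0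
  ... | no  _   = refl

  w-cong : ∀ {x y} → x ≈ y → w x ≈ w y
  w-cong {x} {y} x≈y with y ≟ 0#
  ... | yes y≈0 = w-zero (trans x≈y y≈0)
  ... | no  y≉0 = trans (w-nonzero (y≉0 ∘ trans (sym x≈y))) x≈y

  w-invertible : ∀ x → Invertible (w x)
  w-invertible x with x ≟ 0#
  ... | yes _   = 1# , *-identityˡ 1#
  ... | no  x≉0 = invertible x≉0

  ∏w : Carrier
  ∏w = ∏ (w ∘ enum)

  scale-cancels : ∀ {x y} → x * y ≈ 1# → ∀ z → x * (y * z) ≈ z
  scale-cancels xy≈1 z = trans (sym (*-assoc _ _ z)) (trans (*-congʳ xy≈1) (*-identityˡ z))

  enum≉0 : ∀ {i} → i ≢ index 0# → enum i ≉ 0#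
  enum≉0 {i} i≢ eq = i≢ (≡.trans (≡.sym (index-enum i)) (index-cong eq))

  x*x^[n-1]≈x^n : ∀ x {n} → 0 < n → x * x ^ (n ∸ 1) ≈ x ^ n
  x*x^[n-1]≈x^n x {suc n} _ = refl

  1<q : 1 < q
  1<q = cardinality≥2 F q card

  0<q : 0 < q
  0<q = ℕ.<⇒≤ 1<q

  -- For x ≉ 0, multiplication by x permutes the field, so the products of w e and of w (x e) agree.
  -- Moreover w (x e) = x w e except at e = 0, where the two values are 1 and x. This one
  -- discrepancy is why x ∏w equals x^q ∏w.
  x^q≈x : ∀ x → x ^ q ≈ x
  x^q≈x x with x ≟ 0#
  ... | yes x≈0 = trans (sym (x*x^[n-1]≈x^n x 0<q)) (trans (*-congʳ x≈0) (trans (zeroˡ _) (sym x≈0)))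
  ... | no  x≉0 = sym (cancelʳ (invertible-sum _ (w-invertible ∘ enum)) x (x ^ q) (begin
    x * ∏ (w ∘ enum)
      ≈⟨ *-congˡ (sum-bijection *-commutativeMonoid w w-cong (x *_) (inv x *_) *-congˡ *-congˡ
           (scale-cancels (inv-inverse x≉0))
           (scale-cancels (trans (*-comm (inv x) x) (inv-inverse x≉0)))) ⟩
    x * ∏ (w ∘ (x *_) ∘ enum)
      ≈⟨ *-congʳ (trans (*-congˡ (w-zero (enum-index 0#))) (*-identityʳ x)) ⟨
    (x * w (enum (index 0#))) * ∏ (w ∘ (x *_) ∘ enum)
      ≈⟨ sum-exchange *-commutativeMonoid (λ i → x * w (enum i)) (λ i → w (x * enum i)) (index 0#)
           (λ i i≢ → trans (*-congˡ (w-nonzero (enum≉0 i≢)))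
                           (sym (w-nonzero (enum≉0 i≢ ∘ integral x≉0)))) ⟩
    w (x * enum (index 0#)) * ∏ (λ i → x * w (enum i))
      ≈⟨ *-cong (w-zero (trans (*-congˡ (enum-index 0#)) (zeroʳ x))) (∑-distrib-+ (λ _ → x) (w ∘ enum)) ⟩
    1# * (∏ {q} (λ _ → x) * ∏ (w ∘ enum))
      ≈⟨ *-identityˡ _ ⟩
    ∏ {q} (λ _ → x) * ∏ (w ∘ enum)
      ≈⟨ *-congʳ (sum-replicate q) ⟩
    x ^ q * ∏ (w ∘ enum) ∎))

  x^[q-1]≈1 : ∀ {x} → x ≉ 0# → x ^ (q ∸ 1) ≈ 1#
  x^[q-1]≈1 {x} x≉0 = *-cancelʳ-≉0 x≉0 (x ^ (q ∸ 1)) 1#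
    (trans (*-comm _ x) (trans (trans (x*x^[n-1]≈x^n x 0<q) (x^q≈x x)) (sym (*-identityˡ x))))

-- Wilson's theorem: t^(q-1) - 1 is the product of t - e over the nonzero
-- elements e; evaluate at t = 0.
∏w≈-1 : ∀ {a ℓ₁ ℓ₂ : Level} (F : HeytingField a ℓ₁ ℓ₂) q (card : HasCardinality F q) →
        let open HeytingField F in FiniteField.∏w F q card ≈ - 1#
∏w≈-1 F 0 card = contradiction (cardinality≥2 F 0 card) λ ()
∏w≈-1 F 1 card = contradiction (cardinality≥2 F 1 card) λ { (s≤s ()) }
∏w≈-1 F (suc (suc k)) card = begin
  ∏ (w ∘ enum)
    -- After the reindexing by negation the factors are 0 - e, as in the factorization at t = 0, and
    -- no sign (-1)^(q-1) has to be evaluated.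
    ≈⟨ sum-bijection *-commutativeMonoid w w-cong -_ -_ -‿cong -‿cong -‿involutive -‿involutive ⟩
  ∏ (w ∘ -_ ∘ enum)
    ≈⟨ sum-remove {i = index 0#} (w ∘ -_ ∘ enum) ⟩
  w (- enum (index 0#)) * ∏ (w ∘ -_ ∘ e)
    ≈⟨ *-cong (w-zero (trans (-‿cong (enum-index 0#)) -0#≈0#))
              (sum-cong-≋ λ i → w-nonzero (e≉0 i ∘ λ eq → trans (sym (-‿involutive _)) (trans (-‿cong eq) -0#≈0#))) ⟩
  1# * ∏ (-_ ∘ e)
    ≈⟨ *-identityˡ _ ⟩
  ∏ (-_ ∘ e)
    ≈⟨ sum-cong-≋ (λ i → +-identityˡ (- e i)) ⟨
  ∏ (λ i → 0# - e i)
    ≈⟨ monic-roots integral (suc k) monic e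
         (Fin.punchIn-injective (index 0#) _ _ ∘ enum-injective)
         (λ i → trans (+-congˡ (x^[q-1]≈1 (e≉0 i))) (-‿inverseˡ 1#)) 0# ⟨
  - 1# + 0# ^ suc k
    -- The power of 0 vanishes because its exponent q - 1 = `suc k` is positive.
    ≈⟨ trans (+-congˡ (zeroˡ _)) (+-identityʳ _) ⟩
  - 1# ∎
  where
  R = HeytingCommutativeRing.commutativeRing (HeytingField.heytingCommutativeRing F)
  open CommutativeRing R hiding (zero)
  open RingProperties ring
  open Exp semiring using (_^_)
  open Sum *-commutativeMonoid using (sum-cong-≋; sum-remove) renaming (sum to ∏)
  open SetoidReasoning setoid
  open FiniteField F (2 ℕ.+ k) card
  open MonicFunctions R
  e : Fin (suc k) → Carrier
  e = enum ∘ punchIn (index 0#)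
  e≉0 : ∀ i → e i ≉ 0#
  e≉0 i = enum≉0 (Fin.punchInᵢ≢i (index 0#) i)
  monic : Monic (suc k) (λ t → - 1# + t ^ suc k)
  monic = - 1# , _ , monic-^ k , λ _ → refl

-- Least witnesses of decidable predicates.

least : ∀ {p} {P : ℕ → Set p} → (∀ n → Dec (P n)) → ∀ n → P n → ∃ (IsLeast P)
least {P = P} P? = <-rec (λ n → P n → ∃ (IsLeast P)) λ n smaller Pn → search n smaller Pn (ℕ.anyUpTo? P? n)
  where
  search : ∀ n → (∀ {m} → m < n → P m → ∃ (IsLeast P)) → P n →
           Dec (∃ λ m → m < n × P m) → ∃ (IsLeast P)
  search n smaller Pn (yes (m , m<n , Pm)) = smaller m<n Pm
  search n smaller Pn (no  none)           = n , Pn , λ m Pm → ℕ.≮⇒≥ λ m<n → none (m , m<n , Pm)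

-- Coefficients of products of polynomials.

module PolynomialProperties {a ℓ : Level} (R : CommutativeRing a ℓ) where

  open CommutativeRing R hiding (zero)
  open Polynomial R
  open RingProperties ring
  open SemiringSolver commutativeSemiring
  open SetoidReasoning setoid

  coeff-+ : ∀ p s n → coeff (p +ₚ s) n ≈ coeff p n + coeff s n
  coeff-+ []      s       n       = sym (+-identityˡ _)
  coeff-+ (x ∷ p) []      n       = sym (+-identityʳ _)
  coeff-+ (x ∷ p) (y ∷ s) zero    = refl
  coeff-+ (x ∷ p) (y ∷ s) (suc n) = coeff-+ p s n

  coeff-map-* : ∀ x s n → coeff (map (x *_) s) n ≈ x * coeff s n
  coeff-map-* x []      n       = sym (zeroʳ x)
  coeff-map-* x (y ∷ s) zero    = refl
  coeff-map-* x (y ∷ s) (suc n) = coeff-map-* x s n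

  coeff-∷-*-zero : ∀ x p s → coeff ((x ∷ p) *ₚ s) 0 ≈ x * coeff s 0
  coeff-∷-*-zero x p s = trans (coeff-+ (map (x *_) s) _ 0) (trans (+-identityʳ _) (coeff-map-* x s 0))

  coeff-∷-*-suc : ∀ x p s n → coeff ((x ∷ p) *ₚ s) (suc n) ≈ x * coeff s (suc n) + coeff (p *ₚ s) n
  coeff-∷-*-suc x p s n = trans (coeff-+ (map (x *_) s) _ (suc n)) (+-congʳ (coeff-map-* x s (suc n)))

  coeff-*-∷-zero : ∀ s x p → coeff (s *ₚ (x ∷ p)) 0 ≈ x * coeff s 0
  coeff-*-∷-zero []      x p = sym (zeroʳ x)
  coeff-*-∷-zero (y ∷ s) x p = trans (coeff-∷-*-zero y s (x ∷ p)) (*-comm y x)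

  -- `_*ₚ_` recurses on its left factor; this mirror recursion on the right factor is what makes
  -- commutativity a plain induction.
  coeff-*-∷-suc : ∀ s x p n → coeff (s *ₚ (x ∷ p)) (suc n) ≈ x * coeff s (suc n) + coeff (s *ₚ p) n
  coeff-*-∷-suc []      x p n = sym (trans (+-identityʳ _) (zeroʳ x))
  coeff-*-∷-suc (y ∷ s) x p zero = begin
    coeff ((y ∷ s) *ₚ (x ∷ p)) 1                ≈⟨ coeff-∷-*-suc y s (x ∷ p) 0 ⟩
    y * coeff p 0 + coeff (s *ₚ (x ∷ p)) 0      ≈⟨ +-congˡ (coeff-*-∷-zero s x p) ⟩
    y * coeff p 0 + x * coeff s 0               ≈⟨ +-comm _ _ ⟩
    x * coeff s 0 + y * coeff p 0               ≈⟨ +-congˡ (coeff-∷-*-zero y s p) ⟨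
    x * coeff s 0 + coeff ((y ∷ s) *ₚ p) 0      ∎
  coeff-*-∷-suc (y ∷ s) x p (suc n) = begin
    coeff ((y ∷ s) *ₚ (x ∷ p)) (suc (suc n))
      ≈⟨ coeff-∷-*-suc y s (x ∷ p) (suc n) ⟩
    y * coeff p (suc n) + coeff (s *ₚ (x ∷ p)) (suc n)
      ≈⟨ +-congˡ (coeff-*-∷-suc s x p n) ⟩
    y * coeff p (suc n) + (x * coeff s (suc n) + coeff (s *ₚ p) n)
      ≈⟨ solve 3 (λ u v w → u :+ (v :+ w) := v :+ (u :+ w)) refl _ _ _ ⟩
    x * coeff s (suc n) + (y * coeff p (suc n) + coeff (s *ₚ p) n)
      ≈⟨ +-congˡ (coeff-∷-*-suc y s p n) ⟨
    x * coeff s (suc n) + coeff ((y ∷ s) *ₚ p) (suc n) ∎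

  -- Divisibility puts the quotient to the left of the divisor, while the equation defining the hᵢ
  -- puts f first; this passes between the two.
  *ₚ-comm : ∀ p s → p *ₚ s ≈ₚ s *ₚ p
  *ₚ-comm []      []      n = refl
  *ₚ-comm []      (y ∷ s) zero = sym (trans (coeff-∷-*-zero y s []) (zeroʳ y))
  *ₚ-comm []      (y ∷ s) (suc n) = sym (begin
    coeff ((y ∷ s) *ₚ []) (suc n) ≈⟨ coeff-∷-*-suc y s [] n ⟩
    y * 0# + coeff (s *ₚ []) n    ≈⟨ +-cong (zeroʳ y) (sym (*ₚ-comm [] s n)) ⟩
    0# + 0#                       ≈⟨ +-identityʳ 0# ⟩
    0#                            ∎)
  *ₚ-comm (x ∷ p) s zero    = trans (coeff-∷-*-zero x p s) (sym (coeff-*-∷-zero s x p))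
  *ₚ-comm (x ∷ p) s (suc n) = begin
    coeff ((x ∷ p) *ₚ s) (suc n)             ≈⟨ coeff-∷-*-suc x p s n ⟩
    x * coeff s (suc n) + coeff (p *ₚ s) n   ≈⟨ +-congˡ (*ₚ-comm p s n) ⟩
    x * coeff s (suc n) + coeff (s *ₚ p) n   ≈⟨ coeff-*-∷-suc s x p n ⟨
    coeff (s *ₚ (x ∷ p)) (suc n)             ∎

  *ₚ-congˡ : ∀ p {s t} → s ≈ₚ t → p *ₚ s ≈ₚ p *ₚ t
  *ₚ-congˡ []      s≈t n = refl
  *ₚ-congˡ (x ∷ p) {s} {t} s≈t zero = trans (coeff-∷-*-zero x p s)
    (trans (*-congˡ (s≈t 0)) (sym (coeff-∷-*-zero x p t)))
  *ₚ-congˡ (x ∷ p) {s} {t} s≈t (suc n) = trans (coeff-∷-*-suc x p s n)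
    (trans (+-cong (*-congˡ (s≈t (suc n))) (*ₚ-congˡ p s≈t n)) (sym (coeff-∷-*-suc x p t n)))

  coeff-C-* : ∀ x s n → coeff (C x *ₚ s) n ≈ x * coeff s n
  coeff-C-* x s zero    = coeff-∷-*-zero x [] s
  coeff-C-* x s (suc n) = trans (coeff-∷-*-suc x [] s n) (+-identityʳ _)

  coeff-X^-zero : ∀ n → coeff (X ^ₚ suc n) 0 ≈ 0#
  coeff-X^-zero n = trans (coeff-∷-*-zero 0# (C 1#) (X ^ₚ n)) (zeroˡ _)

  coeff-X^-suc : ∀ n k → coeff (X ^ₚ suc n) (suc k) ≈ coeff (X ^ₚ n) k
  coeff-X^-suc n k = begin
    coeff (X ^ₚ suc n) (suc k)                              ≈⟨ coeff-∷-*-suc 0# (C 1#) (X ^ₚ n) k ⟩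
    0# * coeff (X ^ₚ n) (suc k) + coeff (C 1# *ₚ X ^ₚ n) k  ≈⟨ +-cong (zeroˡ _) (coeff-C-* 1# (X ^ₚ n) k) ⟩
    0# + 1# * coeff (X ^ₚ n) k                              ≈⟨ solve 1 (λ u → con 0 :+ con 1 :* u := u) refl _ ⟩
    coeff (X ^ₚ n) k                                        ∎

  quadratic : ∀ b c → X ^ₚ 2 +ₚ C b *ₚ X +ₚ C c ≈ₚ c ∷ b ∷ 1# ∷ []
  quadratic b c n = trans
    (trans (coeff-+ (X ^ₚ 2 +ₚ C b *ₚ X) (C c) n)
           (+-congʳ (trans (coeff-+ (X ^ₚ 2) (C b *ₚ X) n) (+-congˡ (coeff-C-* b X n)))))
    (coefficients n)
    where
    coefficients : ∀ n → coeff (X ^ₚ 2) n + b * coeff X n + coeff (C c) n ≈ coeff (c ∷ b ∷ 1# ∷ []) n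
    coefficients 0 = trans (+-congʳ (+-congʳ (coeff-X^-zero 1)))
      (solve 2 (λ b c → con 0 :+ b :* con 0 :+ c := c) refl b c)
    coefficients 1 = trans (+-congʳ (+-congʳ (trans (coeff-X^-suc 1 0) (coeff-X^-zero 0))))
      (solve 1 (λ b → con 0 :+ b :* con 1 :+ con 0 := b) refl b)
    coefficients 2 = trans (+-congʳ (+-congʳ (trans (coeff-X^-suc 1 1) (coeff-X^-suc 0 0))))
      (solve 1 (λ b → con 1 :+ b :* con 0 :+ con 0 := con 1) refl b)
    coefficients (suc (suc (suc n))) = trans (+-congʳ (+-congʳ (trans (coeff-X^-suc 1 (2 ℕ.+ n)) (coeff-X^-suc 0 (1 ℕ.+ n)))))
      (solve 1 (λ b → con 0 :+ b :* con 0 :+ con 0 := con 0) refl b)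

  -- Cancellation from the constant term upwards, as for power series: the lowest coefficient of the
  -- product determines h n, and removing its contribution leaves the same problem with one
  -- coefficient less.
  descending-cancelʳ : ∀ p → (∀ x y → x * coeff p 0 ≈ y * coeff p 0 → x ≈ y) →
                       ∀ h h′ n → descending h n *ₚ p ≈ₚ descending h′ n *ₚ p →
                       ∀ i → i < n → h (suc i) ≈ h′ (suc i)
  descending-cancelʳ p cancel h h′ (suc n) hp≈h′p i i<1+n = [ below , at ]′ (ℕ.m<1+n⇒m<n∨m≡n i<1+n)
    where
    top : h (suc n) ≈ h′ (suc n)
    top = cancel _ _ (begin
      h (suc n) * coeff p 0             ≈⟨ coeff-∷-*-zero _ (descending h n) p ⟨
      coeff (descending h (suc n) *ₚ p) 0  ≈⟨ hp≈h′p 0 ⟩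
      coeff (descending h′ (suc n) *ₚ p) 0 ≈⟨ coeff-∷-*-zero _ (descending h′ n) p ⟩
      h′ (suc n) * coeff p 0            ∎)
    rest : descending h n *ₚ p ≈ₚ descending h′ n *ₚ p
    rest k = +-cancelˡ (h (suc n) * coeff p (suc k)) _ _ (begin
      h (suc n) * coeff p (suc k) + coeff (descending h n *ₚ p) k   ≈⟨ coeff-∷-*-suc _ (descending h n) p k ⟨
      coeff (descending h (suc n) *ₚ p) (suc k)                     ≈⟨ hp≈h′p (suc k) ⟩
      coeff (descending h′ (suc n) *ₚ p) (suc k)                    ≈⟨ coeff-∷-*-suc _ (descending h′ n) p k ⟩
      h′ (suc n) * coeff p (suc k) + coeff (descending h′ n *ₚ p) k ≈⟨ +-congʳ (*-congʳ top) ⟨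
      h (suc n) * coeff p (suc k) + coeff (descending h′ n *ₚ p) k  ∎)
    below : i < n → h (suc i) ≈ h′ (suc i)
    below = descending-cancelʳ p cancel h h′ n rest i
    at : i ≡ n → h (suc i) ≈ h′ (suc i)
    at ≡.refl = top

-- Evaluation in the extension and divisibility by f.

module QuadraticEvaluation {a ℓ : Level} (R : CommutativeRing a ℓ)
  (b c : CommutativeRing.Carrier R) where

  open CommutativeRing R hiding (zero)
  open Polynomial R
  open PolynomialProperties R
  open RingProperties ring
  open SemiringSolver commutativeSemiring
  open QuadraticExtension commutativeSemiring (- b) (- c) public

  module K = CommutativeSemiring extension
  open Exp K.semiring public using () renaming (_^_ to _^ᴷ_)

  f : Poly
  f = X ^ₚ 2 +ₚ C b *ₚ X +ₚ C c

  -- This is X^(n+1) = f · (s₁ X^(n-1) + ⋯ + sₙ) + sₙ₊₁ X - c sₙ, where s is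
  -- α-coefficient.
  descending-α-*-f : ∀ n k → coeff (descending α-coefficient n *ₚ f) k ≈
    coeff (c * α-coefficient n ∷ - α-coefficient (suc n) ∷ []) k + coeff (X ^ₚ suc n) k
  descending-α-*-f n k = trans (*ₚ-congˡ (descending s n) (quadratic b c) k) (coefficients n k)
    where
    open SetoidReasoning setoid
    s = α-coefficient
    coefficients : ∀ n k → coeff (descending s n *ₚ (c ∷ b ∷ 1# ∷ [])) k ≈
      coeff (c * s n ∷ - s (suc n) ∷ []) k + coeff (X ^ₚ suc n) k
    coefficients zero 0 = sym (trans (+-cong (zeroʳ c) (coeff-X^-zero 0)) (+-identityʳ 0#))
    coefficients zero 1 = sym (trans (+-congˡ (coeff-X^-suc 0 0)) (-‿inverseˡ 1#))
    coefficients zero (suc (suc k)) = sym (trans (+-identityˡ _) (coeff-X^-suc 0 (suc k)))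
    coefficients (suc n) 0 = begin
      coeff (descending s (suc n) *ₚ (c ∷ b ∷ 1# ∷ [])) 0 ≈⟨ coeff-∷-*-zero _ (descending s n) (c ∷ b ∷ 1# ∷ []) ⟩
      s (suc n) * c                                       ≈⟨ *-comm _ c ⟩
      c * s (suc n)                                       ≈⟨ +-identityʳ _ ⟨
      c * s (suc n) + 0#                                  ≈⟨ +-congˡ (coeff-X^-zero (suc n)) ⟨
      c * s (suc n) + coeff (X ^ₚ suc (suc n)) 0          ∎
    coefficients (suc n) 1 = begin
      coeff (descending s (suc n) *ₚ (c ∷ b ∷ 1# ∷ [])) 1
        ≈⟨ coeff-∷-*-suc _ (descending s n) (c ∷ b ∷ 1# ∷ []) 0 ⟩
      s (suc n) * b + coeff (descending s n *ₚ (c ∷ b ∷ 1# ∷ [])) 0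
        ≈⟨ +-congˡ (coefficients n 0) ⟩
      s (suc n) * b + (c * s n + coeff (X ^ₚ suc n) 0)
        ≈⟨ solve 5 (λ s′ b c s x → s′ :* b :+ (c :* s :+ x) := b :* s′ :+ c :* s :+ x) refl _ b c _ _ ⟩
      b * s (suc n) + c * s n + coeff (X ^ₚ suc n) 0
        ≈⟨ +-cong (+-cong (-‿involutive _) (-‿involutive _)) (coeff-X^-suc (suc n) 0) ⟨
      - - (b * s (suc n)) + - - (c * s n) + coeff (X ^ₚ suc (suc n)) 1
        ≈⟨ +-congʳ (-‿+-comm _ _) ⟩
      - (- (b * s (suc n)) + - (c * s n)) + coeff (X ^ₚ suc (suc n)) 1
        ≈⟨ +-congʳ (-‿cong (trans (+-comm _ _) (+-cong (-‿distribˡ-* c _) (-‿distribˡ-* b _)))) ⟩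
      - s (suc (suc n)) + coeff (X ^ₚ suc (suc n)) 1 ∎
    coefficients (suc n) 2 = begin
      coeff (descending s (suc n) *ₚ (c ∷ b ∷ 1# ∷ [])) 2
        ≈⟨ coeff-∷-*-suc _ (descending s n) (c ∷ b ∷ 1# ∷ []) 1 ⟩
      s (suc n) * 1# + coeff (descending s n *ₚ (c ∷ b ∷ 1# ∷ [])) 1
        ≈⟨ +-congˡ (coefficients n 1) ⟩
      s (suc n) * 1# + (- s (suc n) + coeff (X ^ₚ suc n) 1)
        ≈⟨ trans (+-congʳ (*-identityʳ _)) (sym (+-assoc _ _ _)) ⟩
      s (suc n) - s (suc n) + coeff (X ^ₚ suc n) 1
        ≈⟨ +-cong (-‿inverseʳ _) (sym (coeff-X^-suc (suc n) 1)) ⟩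
      0# + coeff (X ^ₚ suc (suc n)) 2 ∎
    coefficients (suc n) (suc (suc (suc k))) = begin
      coeff (descending s (suc n) *ₚ (c ∷ b ∷ 1# ∷ [])) (3 ℕ.+ k)
        ≈⟨ coeff-∷-*-suc _ (descending s n) (c ∷ b ∷ 1# ∷ []) (2 ℕ.+ k) ⟩
      s (suc n) * 0# + coeff (descending s n *ₚ (c ∷ b ∷ 1# ∷ [])) (2 ℕ.+ k)
        ≈⟨ +-cong (zeroʳ _) (trans (coefficients n (2 ℕ.+ k)) (+-identityˡ _)) ⟩
      0# + coeff (X ^ₚ suc n) (2 ℕ.+ k)
        ≈⟨ +-congˡ (coeff-X^-suc (suc n) (2 ℕ.+ k)) ⟨
      0# + coeff (X ^ₚ suc (suc n)) (3 ℕ.+ k) ∎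

  eval : K.Carrier → Poly → K.Carrier
  eval t []      = K.0#
  eval t (x ∷ p) = ι x K.+ t K.* eval t p

  eval-zero : ∀ t p → p ≈ₚ [] → eval t p K.≈ K.0#
  eval-zero t []      p≈0 = K.refl
  eval-zero t (x ∷ p) p≈0 = K.trans
    (K.+-cong (ι-cong (p≈0 0)) (K.trans (K.*-congˡ {t} (eval-zero t p (p≈0 ∘ suc))) (K.zeroʳ t)))
    (K.+-identityʳ K.0#)

  eval-cong : ∀ t p s → p ≈ₚ s → eval t p K.≈ eval t s
  eval-cong t []      s       p≈s = K.sym (eval-zero t s (λ n → sym (p≈s n)))
  eval-cong t (x ∷ p) []      p≈s = eval-zero t (x ∷ p) p≈s
  eval-cong t (x ∷ p) (y ∷ s) p≈s =
    K.+-cong (ι-cong (p≈s 0)) (K.*-congˡ {t} (eval-cong t p s (p≈s ∘ suc)))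

  module _ (t : K.Carrier) where

    open SemiringSolver extension
      using () renaming (solve to solveᴷ; _:=_ to _⊜_; _:+_ to _⊕_; _:*_ to _⊗_; con to conᴷ)

    eval-+ : ∀ p s → eval t (p +ₚ s) K.≈ eval t p K.+ eval t s
    eval-+ []      s       = K.sym (K.+-identityˡ _)
    eval-+ (x ∷ p) []      = K.sym (K.+-identityʳ _)
    eval-+ (x ∷ p) (y ∷ s) = K.trans
      (K.+-cong (ι-homo-+ x y) (K.*-congˡ {t} (eval-+ p s)))
      (solveᴷ 5 (λ x y t p s → (x ⊕ y) ⊕ t ⊗ (p ⊕ s) ⊜ (x ⊕ t ⊗ p) ⊕ (y ⊕ t ⊗ s))
        K.refl (ι x) (ι y) t (eval t p) (eval t s))

    eval-map-* : ∀ x s → eval t (map (x *_) s) K.≈ ι x K.* eval t s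
    eval-map-* x []      = K.sym (K.zeroʳ (ι x))
    eval-map-* x (y ∷ s) = K.trans
      (K.+-cong (ι-homo-* x y) (K.*-congˡ {t} (eval-map-* x s)))
      (solveᴷ 4 (λ x y t s → x ⊗ y ⊕ t ⊗ (x ⊗ s) ⊜ x ⊗ (y ⊕ t ⊗ s)) K.refl (ι x) (ι y) t (eval t s))

    eval-* : ∀ p s → eval t (p *ₚ s) K.≈ eval t p K.* eval t s
    eval-* []      s = K.sym (K.zeroˡ (eval t s))
    eval-* (x ∷ p) s = K.trans
      (K.trans (eval-+ (map (x *_) s) (0# ∷ p *ₚ s))
               (K.+-cong (eval-map-* x s) (K.+-congˡ {K.0#} (K.*-congˡ {t} (eval-* p s)))))
      (solveᴷ 4 (λ x t p s → x ⊗ s ⊕ (conᴷ 0 ⊕ t ⊗ (p ⊗ s)) ⊜ (x ⊕ t ⊗ p) ⊗ s)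
        K.refl (ι x) t (eval t p) (eval t s))

    eval-C : ∀ x → eval t (C x) K.≈ ι x
    eval-C x = K.trans (K.+-congˡ {ι x} (K.zeroʳ t)) (K.+-identityʳ (ι x))

    eval-X : eval t X K.≈ t
    eval-X = K.trans (K.+-identityˡ _) (K.trans (K.*-congˡ {t} (eval-C 1#)) (K.*-identityʳ t))

    eval-X^ : ∀ n → eval t (X ^ₚ n) K.≈ t ^ᴷ n
    eval-X^ zero    = eval-C 1#
    eval-X^ (suc n) = K.trans (eval-* X (X ^ₚ n)) (K.*-cong eval-X (eval-X^ n))

    eval-∣ₚ : ∀ {p s} → p ∣ₚ s → eval t p K.≈ K.0# → eval t s K.≈ K.0#
    eval-∣ₚ {p} {s} p∣s p[t]≈0 = K.trans
      (K.sym (K.trans (K.sym (eval-* u p)) (eval-cong t (u *ₚ p) s (_∣ʳ_.equality p∣s))))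
      (K.trans (K.*-congˡ {eval t u} p[t]≈0) (K.zeroʳ (eval t u)))
      where u = _∣ʳ_.quotient p∣s

  eval-linear : ∀ t y → eval t (y ∷ 1# ∷ []) K.≈ ι y K.+ t
  eval-linear t y = K.+-congˡ {ι y} (K.trans (K.*-congˡ {t} (eval-C t 1#)) (K.*-identityʳ t))

  eval-f : eval α f K.≈ K.0#
  eval-f = K.trans (eval-cong α f (c ∷ b ∷ 1# ∷ []) (quadratic b c))
    (K.trans (K.+-congˡ {ι c} (K.trans
        (K.*-congˡ {α} (K.trans (eval-linear α b) (+-identityʳ b , +-identityˡ 1#)))
        (K.trans (α-* b 1#) (*-identityʳ (- c) , trans (+-congˡ (*-identityʳ (- b))) (-‿inverseʳ b)))))
      (-‿inverseʳ c , +-identityʳ 0#))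

  f∣X^n-μ⇒α^n≈μ : ∀ n μ → f ∣ₚ (X ^ₚ n -ₚ C μ) → α ^ᴷ n K.≈ ι μ
  f∣X^n-μ⇒α^n≈μ n μ f∣ = begin
    α ^ᴷ n                          ≈⟨ K.+-identityʳ _ ⟨
    α ^ᴷ n K.+ K.0#                 ≈⟨ K.+-congˡ {α ^ᴷ n} (-‿inverseˡ μ , +-identityʳ 0#) ⟨
    α ^ᴷ n K.+ (ι (- μ) K.+ ι μ)    ≈⟨ K.+-assoc (α ^ᴷ n) (ι (- μ)) (ι μ) ⟨
    α ^ᴷ n K.+ ι (- μ) K.+ ι μ      ≈⟨ K.+-congʳ {ι μ} (K.+-cong (eval-X^ α n) (eval-C α (- μ))) ⟨
    eval α (X ^ₚ n) K.+ eval α (C (- μ)) K.+ ι μ ≈⟨ K.+-congʳ {ι μ} (eval-+ α (X ^ₚ n) (C (- μ))) ⟨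
    eval α (X ^ₚ n -ₚ C μ) K.+ ι μ  ≈⟨ K.+-congʳ {ι μ} (eval-∣ₚ α {f} {X ^ₚ n -ₚ C μ} f∣ eval-f) ⟩
    K.0# K.+ ι μ                    ≈⟨ K.+-identityˡ (ι μ) ⟩
    ι μ                             ∎
    where open SetoidReasoning K.setoid

  -- The coordinates of αⁿ are, up to sign, the coefficients in the division formula
  -- `descending-α-*-f`. If they are (μ , 0), that formula already exhibits the quotient.
  α^n≈μ⇒f∣X^n-μ : ∀ {n} → 0 < n → ∀ μ → α ^ᴷ n K.≈ ι μ → f ∣ₚ (X ^ₚ n -ₚ C μ)
  α^n≈μ⇒f∣X^n-μ {suc n} _ μ α^n≈μ = record
    { quotient = descending α-coefficient n
    ; equality = λ k → trans (descending-α-*-f n k)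
        (trans (+-comm _ _) (trans (+-congˡ (remainder k)) (sym (coeff-+ (X ^ₚ suc n) (-ₚ C μ) k))))
    }
    where
    coordinates : (- c * α-coefficient n , α-coefficient (suc n)) K.≈ ι μ
    coordinates = K.trans (K.sym (α^[1+n] n)) α^n≈μ
    remainder : ∀ k → coeff (c * α-coefficient n ∷ - α-coefficient (suc n) ∷ []) k ≈ coeff (-ₚ C μ) k
    remainder 0 = trans (sym (-‿involutive _))
      (-‿cong (trans (-‿distribˡ-* c _) (proj₁ coordinates)))
    remainder 1 = trans (-‿cong (proj₂ coordinates)) -0#≈0#
    remainder (suc (suc k)) = refl

-- Irreducible quadratics over a finite field: units and α^(q+1).

module IrreducibleQuadratic {a ℓ₁ ℓ₂ : Level} (F : HeytingField a ℓ₁ ℓ₂) (q : ℕ)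
  (card : HasCardinality F q) (b c : HeytingField.Carrier F) where

  private
    R = HeytingCommutativeRing.commutativeRing (HeytingField.heytingCommutativeRing F)

  open CommutativeRing R hiding (zero)
  open Polynomial R
  open PolynomialProperties R
  open QuadraticEvaluation R b c
  open FiniteField F q card
  open RingProperties ring
  open Exp semiring using (_^_)
  open Exp K.semiring using () renaming (^-homo-* to ^ᴷ-homo-*; ^-assocʳ to ^ᴷ-assocʳ; ^-congˡ to ^ᴷ-congˡ)
  open InvertibleElements *-commutativeMonoid using (Invertible)
  open InvertibleElements K.*-commutativeMonoid using ()
    renaming (Invertible to Invertibleᴷ; invertible-∙ to invertibleᴷ-*; invertible-sum to invertibleᴷ-∏; cancelʳ to cancelʳᴷ)
  open Sum *-commutativeMonoid using () renaming (sum to ∏)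
  open Sum K.*-commutativeMonoid using () renaming (sum to ∏ᴷ)
  open SemiringSolver commutativeSemiring

  private
    s = α-coefficient
    β = - b
    γ = - c

  -- Evaluate at the root -a: every multiple of a + X vanishes there, and 1 does not.
  linear∤1 : ∀ a → ¬ ((a ∷ 1# ∷ []) ∣ₚ C 1#)
  linear∤1 a a+X∣1 = 1≉0 (proj₁ (K.trans (K.sym (eval-C t 1#))
    (eval-∣ₚ t {a ∷ 1# ∷ []} {C 1#} a+X∣1
      (K.trans (eval-linear t a) (-‿inverseʳ a , +-identityʳ 0#)))))
    where t = ι (- a)

  invertibleᴷ-ι : ∀ {x} → x ≉ 0# → Invertibleᴷ (ι x)
  invertibleᴷ-ι x≉0 with invertible x≉0
  ... | y , xy≈1 = ι y , K.trans (K.sym (ι-homo-* _ y)) (ι-cong xy≈1)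

  invertibleᴷ⇒≉0 : ∀ {x} → Invertibleᴷ x → ¬ x K.≈ K.0#
  invertibleᴷ⇒≉0 (y , xy≈1) x≈0 =
    1≉0 (proj₁ (K.trans (K.sym xy≈1) (K.trans (K.*-congʳ {y} x≈0) (K.zeroˡ y))))

  invertibleᴷ-^ : ∀ {x} → Invertibleᴷ x → ∀ n → Invertibleᴷ (x ^ᴷ n)
  invertibleᴷ-^ x-inv zero    = K.1# , K.*-identityˡ K.1#
  invertibleᴷ-^ x-inv (suc n) = invertibleᴷ-* x-inv (invertibleᴷ-^ x-inv n)

  module _ (irreducible : Irreducible f) where

    -- Otherwise f would be (a + X)(d + X), a product of two nonunits. All uses of irreducibility
    -- pass through this form.
    noLinearFactors : ∀ a d → d + a ≈ b → a * d ≉ c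
    noLinearFactors a d d+a≈b ad≈c = [ linear∤1 a , linear∤1 d ]′
      (Irreducible.split-∣1 irreducible f≈)
      where
      f≈ : f ≈ₚ (a ∷ 1# ∷ []) *ₚ (d ∷ 1# ∷ [])
      f≈ n = trans (quadratic b c n) (coefficients n)
        where
        coefficients : ∀ n → coeff (c ∷ b ∷ 1# ∷ []) n ≈ coeff ((a ∷ 1# ∷ []) *ₚ (d ∷ 1# ∷ [])) n
        coefficients 0 = trans (sym ad≈c) (sym (+-identityʳ _))
        coefficients 1 = trans (sym d+a≈b)
          (solve 2 (λ a d → d :+ a := a :* con 1 :+ (con 1 :* d :+ con 0)) refl a d)
        coefficients 2 = sym (*-identityʳ 1#)
        coefficients (suc (suc (suc n))) = refl

    c≉0 : c ≉ 0#
    c≉0 c≈0 = noLinearFactors 0# b (+-identityʳ b) (trans (zeroˡ b) (sym c≈0))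

    γ≉0 : γ ≉ 0#
    γ≉0 γ≈0 = c≉0 (trans (sym (-‿involutive c)) (trans (-‿cong γ≈0) -0#≈0#))

    -- The conjugate of a + α is -(d + α) with d = b - a, so (a + α)(d + α) is minus
    -- the norm.
    invertibleᴷ-a+α : ∀ a → Invertibleᴷ (a , 1#)
    invertibleᴷ-a+α a = (d , 1#) K.* ι n⁻¹ , (begin
      (a , 1#) K.* ((d , 1#) K.* ι n⁻¹) ≈⟨ K.*-assoc (a , 1#) (d , 1#) (ι n⁻¹) ⟨
      ((a , 1#) K.* (d , 1#)) K.* ι n⁻¹ ≈⟨ K.*-congʳ {ι n⁻¹} norm ⟩
      ι (a * d - c) K.* ι n⁻¹           ≈⟨ ι-homo-* (a * d - c) n⁻¹ ⟨
      ι ((a * d - c) * n⁻¹)             ≈⟨ ι-cong (proj₂ n-invertible) ⟩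
      K.1#                              ∎)
      where
      open SetoidReasoning K.setoid
      d = b - a
      d+a≈b : d + a ≈ b
      d+a≈b = trans (+-assoc b (- a) a) (trans (+-congˡ (-‿inverseˡ a)) (+-identityʳ b))
      n-invertible : Invertible (a * d - c)
      n-invertible = invertible (noLinearFactors a d d+a≈b ∘ x∙y⁻¹≈ε⇒x≈y _ _)
      n⁻¹ = proj₁ n-invertible
      norm : (a , 1#) K.* (d , 1#) K.≈ ι (a * d - c)
      norm = solve 3 (λ a d γ → a :* d :+ γ :* (con 1 :* con 1) := a :* d :+ γ) refl a d γ
           , trans (solve 3 (λ a d β → a :* con 1 :+ con 1 :* d :+ β :* (con 1 :* con 1) := (d :+ a) :+ β) refl a d β)
                   (trans (+-congʳ d+a≈b) (-‿inverseʳ b))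

    invertibleᴷ-α : Invertibleᴷ α
    invertibleᴷ-α = invertibleᴷ-a+α 0#

    α^[1+q]≈c : α ^ᴷ suc q K.≈ ι c
    α^[1+q]≈c = cancelʳᴷ (invertibleᴷ-∏ {q} P (invertibleᴷ-a+α ∘ enum)) (α ^ᴷ suc q) (ι c) (begin
      α ^ᴷ suc q K.* ∏ᴷ P
        ≈⟨ α^[1+n]*∏ enum t (σ ∘ enum) (index b) enum[b]+β≈0 (w-zero enum[b]+β≈0)
             (trans (*-congˡ (inv-zero enum[b]+β≈0)) (zeroʳ γ))
             (λ i i≢ → w-nonzero (enum+β≉0 i≢)) tσ≈γ ⟩
      ι γ K.* (ι (∏ t) K.* ∏ᴷ (point ∘ σ ∘ enum))
        ≈⟨ K.*-congˡ {ι γ} (K.*-cong (ι-cong ∏t≈-1) ∏ᴷσ) ⟩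
      ι γ K.* (ι (- 1#) K.* ∏ᴷ P)
        ≈⟨ K.*-assoc (ι γ) (ι (- 1#)) (∏ᴷ P) ⟨
      ι γ K.* ι (- 1#) K.* ∏ᴷ P
        ≈⟨ K.*-congʳ {∏ᴷ P} (K.trans (K.sym (ι-homo-* γ (- 1#))) (ι-cong γ*-1≈c)) ⟩
      ι c K.* ∏ᴷ P ∎)
      where
      open SetoidReasoning K.setoid
      point : Carrier → K.Carrier
      point x = x , 1#
      point-cong : ∀ {x y} → x ≈ y → point x K.≈ point y
      point-cong x≈y = x≈y , refl
      σ : Carrier → Carrier
      σ x = γ * inv (x + β)
      t : Fin q → Carrier
      t i = w (enum i + β)
      P : Fin q → K.Carrier
      P = point ∘ enum
      enum[b]+β≈0 : enum (index b) + β ≈ 0#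
      enum[b]+β≈0 = trans (+-congʳ (enum-index b)) (-‿inverseʳ b)
      enum+β≉0 : ∀ {i} → i ≢ index b → enum i + β ≉ 0#
      enum+β≉0 {i} i≢ eq = i≢ (≡.trans (≡.sym (index-enum i)) (index-cong (x∙y⁻¹≈ε⇒x≈y _ _ eq)))
      tσ≈γ : ∀ i → i ≢ index b → t i * σ (enum i) ≈ γ
      tσ≈γ i i≢ = trans (*-congʳ (w-nonzero (enum+β≉0 i≢)))
        (trans (solve 3 (λ t γ u → t :* (γ :* u) := γ :* (t :* u)) refl _ γ _)
          (trans (*-congˡ (inv-inverse (enum+β≉0 i≢))) (*-identityʳ γ)))
      γ*-1≈c : γ * - 1# ≈ c
      γ*-1≈c = trans (sym (-‿distribʳ-* γ 1#)) (trans (-‿cong (*-identityʳ γ)) (-‿involutive c))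
      translate : ∀ d e → d + e ≈ 0# → ∀ x → (x + d) + e ≈ x
      translate d e d+e≈0 x = trans (+-assoc x d e) (trans (+-congˡ d+e≈0) (+-identityʳ x))
      -- Translation by β permutes F, so the scalars have the same product as in Wilson's theorem.
      ∏t≈-1 : ∏ t ≈ - 1#
      ∏t≈-1 = trans (sym (sum-bijection *-commutativeMonoid w w-cong (_+ β) (_+ b)
        +-congʳ +-congʳ (translate b β (-‿inverseʳ b)) (translate β b (-‿inverseˡ b)))) (∏w≈-1 F q card)
      γγ⁻¹≈1 : γ * inv γ ≈ 1#
      γγ⁻¹≈1 = inv-inverse γ≉0
      -- σ is translation by β, then total inversion, then scaling by γ, each a bijection of F. The
      -- convention inv 0 = 0 is what sends b to 0.
      ∏ᴷσ : ∏ᴷ (point ∘ σ ∘ enum) K.≈ ∏ᴷ P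
      ∏ᴷσ = K.sym (K.trans
        (bijection point point-cong (γ *_) (inv γ *_) *-congˡ *-congˡ
          (scale-cancels γγ⁻¹≈1) (scale-cancels (trans (*-comm _ _) γγ⁻¹≈1)))
        (K.trans
          (bijection (point ∘ (γ *_)) (point-cong ∘ *-congˡ) inv inv inv-cong inv-cong inv-involutive inv-involutive)
          (bijection (point ∘ (γ *_) ∘ inv) (point-cong ∘ *-congˡ ∘ inv-cong) (_+ β) (_+ b)
            +-congʳ +-congʳ (translate b β (-‿inverseʳ b)) (translate β b (-‿inverseˡ b)))))
        where bijection = sum-bijection K.*-commutativeMonoid

    s[1+q]≈0 : s (suc q) ≈ 0#
    s[1+q]≈0 = proj₂ (K.trans (K.sym (α^[1+n] q)) α^[1+q]≈c)

    s[2+q]≈c : s (suc (suc q)) ≈ c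
    s[2+q]≈c = trans
      (+-cong (proj₁ (K.trans (K.sym (α^[1+n] q)) α^[1+q]≈c)) (trans (*-congˡ s[1+q]≈0) (zeroʳ β)))
      (+-identityʳ c)

    f∣X^[1+q]-c : f ∣ₚ (X ^ₚ suc q -ₚ C c)
    f∣X^[1+q]-c = α^n≈μ⇒f∣X^n-μ {suc q} (s≤s z≤n) c α^[1+q]≈c

    -- The coefficients of the quotient H.

    IsH : (ℕ → Carrier) → Set ℓ₁
    IsH h = f *ₚ descending h (suc q) ≈ₚ X ^ₚ suc (suc q) -ₚ C c *ₚ X

    -- In the division formula at n = q + 1 the constant term c s₍q₊₁₎ vanishes and the linear one
    -- is -s₍q₊₂₎ = -c, which leaves X^(q+2) - cX.
    isH-α-coefficient : IsH s
    isH-α-coefficient n = begin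
      coeff (f *ₚ descending s (suc q)) n
        ≈⟨ *ₚ-comm f (descending s (suc q)) n ⟩
      coeff (descending s (suc q) *ₚ f) n
        ≈⟨ descending-α-*-f (suc q) n ⟩
      coeff (c * s (suc q) ∷ - s (suc (suc q)) ∷ []) n + coeff (X ^ₚ suc (suc q)) n
        ≈⟨ trans (+-comm _ _) (+-congˡ (remainder n)) ⟩
      coeff (X ^ₚ suc (suc q)) n + coeff (-ₚ (C c *ₚ X)) n
        ≈⟨ coeff-+ (X ^ₚ suc (suc q)) (-ₚ (C c *ₚ X)) n ⟨
      coeff (X ^ₚ suc (suc q) -ₚ C c *ₚ X) n ∎
      where
      open SetoidReasoning setoid
      remainder : ∀ n → coeff (c * s (suc q) ∷ - s (suc (suc q)) ∷ []) n ≈ coeff (-ₚ (C c *ₚ X)) n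
      remainder 0 = trans (trans (*-congˡ s[1+q]≈0) (zeroʳ c))
        (sym (trans (-‿cong (trans (+-identityʳ _) (zeroʳ c))) -0#≈0#))
      remainder 1 = -‿cong (trans s[2+q]≈c (sym (*-identityʳ c)))
      remainder (suc (suc n)) = refl

    -- The constant coefficient c of f is nonzero, so f cancels. The value `h 0` does not enter the
    -- polynomial, hence the bound 0 < i.
    isH-unique : ∀ h → IsH h → ∀ {i} → 0 < i → i ≤ suc q → h i ≈ s i
    isH-unique h isH {suc i} _ = descending-cancelʳ f cancel h s (suc q) (λ n → trans
      (*ₚ-comm (descending h (suc q)) f n)
      (trans (isH n) (trans (sym (isH-α-coefficient n)) (*ₚ-comm f (descending s (suc q)) n)))) i
      where
      cancel : ∀ x y → x * coeff f 0 ≈ y * coeff f 0 → x ≈ y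
      cancel = *-cancelʳ-≉0 (λ f₀≈0 → c≉0 (trans (sym (quadratic b c 0)) f₀≈0))

    -- The least zero index, the binomial order and the order of f.

    IsZeroIndex : ℕ → Set ℓ₁
    IsZeroIndex i = 2 ≤ i × i ≤ suc q × s i ≈ 0#

    leastZeroIndex : ∃ (IsLeast IsZeroIndex)
    leastZeroIndex = least (λ i → 2 ℕ.≤? i ×-dec i ℕ.≤? suc q ×-dec s i ≟ 0#)
      (suc q) (s≤s 0<q , ℕ.≤-refl , s[1+q]≈0)

    module _ {r : ℕ} (r-least : IsLeast IsZeroIndex r) where

      2≤r : 2 ≤ r
      2≤r = proj₁ (proj₁ r-least)

      0<r : 0 < r
      0<r = ℕ.<⇒≤ 2≤r

      r≤1+q : r ≤ suc q
      r≤1+q = proj₁ (proj₂ (proj₁ r-least))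

      s[r]≈0 : s r ≈ 0#
      s[r]≈0 = proj₂ (proj₂ (proj₁ r-least))

      -- Extends the minimality of r from the range 2, ..., q + 1 to all positive indices: s₁ = 1 is
      -- nonzero, and larger indices exceed q + 1 ≥ r.
      r≤zeroIndex : ∀ n → s (suc n) ≈ 0# → r ≤ suc n
      r≤zeroIndex zero    1≈0 = contradiction 1≈0 1≉0
      r≤zeroIndex (suc n) s≈0 = [ (λ small → proj₂ r-least (2 ℕ.+ n) (s≤s (s≤s z≤n) , small , s≈0))
                                , ℕ.≤-trans r≤1+q ]′
                                (ℕ.≤-total (2 ℕ.+ n) (suc q))

      module _ {μ : Carrier} (α^r≈μ : α ^ᴷ r K.≈ ι μ) where

        μ≉0 : μ ≉ 0#
        μ≉0 μ≈0 = invertibleᴷ⇒≉0 (invertibleᴷ-^ invertibleᴷ-α r) (K.trans α^r≈μ (ι-cong μ≈0))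

        -- Since α is a unit, α^m can be cancelled from x αⁿ + y αᵐ = 0. Then x α^(n-m) = -y lies in
        -- F, so the sequence vanishes at n - m and r ≤ n - m.
        binomial-degree≥r : ∀ g n → IsBinomialOfDegree g n → f ∣ₚ g → r ≤ n
        binomial-degree≥r g n (x , y , m , x≉0 , _ , m<n , g≈) f∣g =
          ≡.subst (r ≤_) n≡ (ℕ.≤-trans (r≤zeroIndex d s[1+d]≈0) (ℕ.m≤n+m (suc d) m))
          where
          open SetoidReasoning K.setoid
          -- Chosen so that n - m is `suc d`, visibly positive.
          d = n ∸ suc m
          n≡ : m ℕ.+ suc d ≡ n
          n≡ = ≡.trans (ℕ.+-suc m d) (ℕ.m+[n∸m]≡n m<n)
          g[α] : eval α g K.≈ (ι x K.* α ^ᴷ suc d K.+ ι y) K.* α ^ᴷ m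
          g[α] = begin
            eval α g
              ≈⟨ eval-cong α g (C x *ₚ X ^ₚ n +ₚ C y *ₚ X ^ₚ m) g≈ ⟩
            eval α (C x *ₚ X ^ₚ n +ₚ C y *ₚ X ^ₚ m)
              ≈⟨ eval-+ α (C x *ₚ X ^ₚ n) (C y *ₚ X ^ₚ m) ⟩
            eval α (C x *ₚ X ^ₚ n) K.+ eval α (C y *ₚ X ^ₚ m)
              ≈⟨ K.+-cong (monomial x n) (monomial y m) ⟩
            ι x K.* α ^ᴷ n K.+ ι y K.* α ^ᴷ m
              ≈⟨ K.+-congʳ {ι y K.* α ^ᴷ m} (K.*-congˡ {ι x} (K.trans (K.reflexive (≡.cong (α ^ᴷ_) (≡.sym n≡)))
                   (K.trans (^ᴷ-homo-* α m (suc d)) (K.*-comm (α ^ᴷ m) (α ^ᴷ suc d))))) ⟩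
            ι x K.* (α ^ᴷ suc d K.* α ^ᴷ m) K.+ ι y K.* α ^ᴷ m
              ≈⟨ K.+-congʳ {ι y K.* α ^ᴷ m} (K.*-assoc (ι x) (α ^ᴷ suc d) (α ^ᴷ m)) ⟨
            ι x K.* α ^ᴷ suc d K.* α ^ᴷ m K.+ ι y K.* α ^ᴷ m
              ≈⟨ K.distribʳ (α ^ᴷ m) (ι x K.* α ^ᴷ suc d) (ι y) ⟨
            (ι x K.* α ^ᴷ suc d K.+ ι y) K.* α ^ᴷ m ∎
            where
            monomial : ∀ x n → eval α (C x *ₚ X ^ₚ n) K.≈ ι x K.* α ^ᴷ n
            monomial x n = K.trans (eval-* α (C x) (X ^ₚ n)) (K.*-cong (eval-C α x) (eval-X^ α n))
          root : ι x K.* α ^ᴷ suc d K.+ ι y K.≈ K.0#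
          root = cancelʳᴷ (invertibleᴷ-^ invertibleᴷ-α m) _ K.0#
            (K.trans (K.sym g[α]) (K.trans (eval-∣ₚ α {f} {g} f∣g eval-f) (K.sym (K.zeroˡ (α ^ᴷ m)))))
          s[1+d]≈0 : s (suc d) ≈ 0#
          s[1+d]≈0 = integral x≉0 (trans (sym (trans (+-identityʳ _) (proj₂
            (K.trans (K.*-congˡ {ι x} (α^[1+n] d)) (ι-*ˡ x _ _))))) (proj₂ root))

        minimalBinomialMultiple : IsMinimalBinomialMultiple f r μ
        minimalBinomialMultiple = record
          { r>0     = 0<r
          ; μ≉0     = μ≉0
          ; divides = α^n≈μ⇒f∣X^n-μ 0<r μ α^r≈μ
          ; minimal = binomial-degree≥r
          }

        multiplicativeOrder : ∃ (IsMultiplicativeOrder μ)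
        multiplicativeOrder = least (λ n → 0 ℕ.<? n ×-dec μ ^ n ≟ 1#)
          -- Fermat's theorem supplies the exponent from which the search descends.
          (q ∸ 1) (ℕ.m<n⇒0<n∸m 1<q , x^[q-1]≈1 μ≉0)

        α^[r*n] : ∀ n → α ^ᴷ (r ℕ.* n) K.≈ ι (μ ^ n)
        α^[r*n] n = K.trans (K.sym (^ᴷ-assocʳ α r n)) (K.trans (^ᴷ-congˡ n α^r≈μ) (K.sym (ι-homo-^ μ n)))

        -- Let αⁿ = 1 with n = j + t r and j < r. Then μ^t α^j = 1 puts α^j in F, so j = 0 by
        -- minimality of r. What remains is μ^t = 1 with t > 0, whence m ≤ t.
        polynomialOrder : ∀ {m} → IsMultiplicativeOrder μ m → IsPolynomialOrder f (r ℕ.* m)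
        polynomialOrder {m} ((0<m , μ^m≈1) , m-least) =
          (0<rm , α^n≈μ⇒f∣X^n-μ 0<rm 1# (K.trans (α^[r*n] m) (ι-cong μ^m≈1))) ,
          λ n (0<n , f∣) → rm≤n n 0<n (f∣X^n-μ⇒α^n≈μ n 1# f∣)
          where
          0<rm : 0 < r ℕ.* m
          0<rm = ℕ.*-mono-< 0<r 0<m
          rm≤n : ∀ n → 0 < n → α ^ᴷ n K.≈ K.1# → r ℕ.* m ≤ n
          rm≤n n 0<n α^n≈1 = byRemainder (n % r) (m%n<n n r) (m≡m%n+[m/n]*n n r)
            where
            instance _ = ℕ.>-nonZero 0<r
            t = n / r
            byRemainder : ∀ j → j < r → n ≡ j ℕ.+ t ℕ.* r → r ℕ.* m ≤ n
            byRemainder zero _ n≡ = ≡.subst (r ℕ.* m ≤_) rt≡n (ℕ.*-monoʳ-≤ r (m-least t (0<t , μ^t≈1)))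
              where
              rt≡n : r ℕ.* t ≡ n
              rt≡n = ≡.trans (ℕ.*-comm r t) (≡.sym n≡)
              0<t : 0 < t
              0<t = ℕ.n≢0⇒n>0 λ t≡0 → ℕ.<⇒≢ 0<n (≡.sym (≡.trans n≡ (≡.cong (ℕ._* r) t≡0)))
              μ^t≈1 : μ ^ t ≈ 1#
              μ^t≈1 = proj₁ (K.trans (K.sym (α^[r*n] t))
                (K.trans (K.reflexive (≡.cong (α ^ᴷ_) rt≡n)) α^n≈1))
            byRemainder (suc j) j<r n≡ = contradiction (r≤zeroIndex j s[1+j]≈0) (ℕ.<⇒≱ j<r)
              where
              α^n : ι (μ ^ t) K.* α ^ᴷ suc j K.≈ K.1#
              α^n = K.trans (K.*-comm (ι (μ ^ t)) (α ^ᴷ suc j))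
                (K.trans (K.*-congˡ {α ^ᴷ suc j} (K.sym (α^[r*n] t)))
                (K.trans (K.sym (^ᴷ-homo-* α (suc j) (r ℕ.* t)))
                (K.trans (K.reflexive (≡.cong (α ^ᴷ_) (≡.trans (≡.cong (suc j ℕ.+_) (ℕ.*-comm r t)) (≡.sym n≡)))) α^n≈1)))
              μ^t≉0 : μ ^ t ≉ 0#
              μ^t≉0 μ^t≈0 = invertibleᴷ⇒≉0 (invertibleᴷ-^ (invertibleᴷ-ι μ≉0) t)
                (K.trans (K.sym (ι-homo-^ μ t)) (ι-cong μ^t≈0))
              s[1+j]≈0 : s (suc j) ≈ 0#
              s[1+j]≈0 = integral μ^t≉0 (proj₂ (K.trans
                (K.sym (K.trans (K.*-congˡ {ι (μ ^ t)} (α^[1+n] j)) (ι-*ˡ (μ ^ t) _ _))) α^n))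

      module _ (h : ℕ → Carrier) (h≈s : ∀ {i} → 0 < i → i ≤ suc q → h i ≈ s i) where

        leastZeroIndex-h : IsLeast (λ i → 2 ≤ i × i ≤ suc q × h i ≈ 0#) r
        leastZeroIndex-h =
          (2≤r , r≤1+q , trans (h≈s (ℕ.<⇒≤ 2≤r) r≤1+q) s[r]≈0) ,
          λ i (2≤i , i≤1+q , h[i]≈0) →
            proj₂ r-least i (2≤i , i≤1+q , trans (sym (h≈s (ℕ.<⇒≤ 2≤i) i≤1+q)) h[i]≈0)

        -- The first coordinate of α^r is -c s₍r₋₁₎, and 2 ≤ r keeps r - 1 among the indices where h
        -- and s agree.
        α^r≈-ch[r-1] : α ^ᴷ r K.≈ ι (- c * h (r ∸ 1))
        α^r≈-ch[r-1] = K.trans (α^n≈ 0<r) (*-congˡ (sym (h≈s 0<r-1 r-1≤1+q)) , s[r]≈0)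
          where
          0<r-1 : 0 < r ∸ 1
          0<r-1 = ℕ.m<n⇒0<n∸m 2≤r
          r-1≤1+q : r ∸ 1 ≤ suc q
          r-1≤1+q = ℕ.≤-trans (ℕ.m∸n≤m r 1) r≤1+q
          α^n≈ : ∀ {n} → 0 < n → α ^ᴷ n K.≈ (γ * s (n ∸ 1) , s n)
          α^n≈ {suc n} _ = α^[1+n] n

theorem6p1 :
    ∀ {a ℓ₁ ℓ₂} (F : HeytingField a ℓ₁ ℓ₂) (q : ℕ) →
    IsPrimePower q → HasCardinality F q →
    let open HeytingField F
        open Polynomial (HeytingCommutativeRing.commutativeRing heytingCommutativeRing)
    in
    (b c : Carrier) →
    let f = X ^ₚ 2 +ₚ C b *ₚ X +ₚ C c
        IsH = λ (h : ℕ → Carrier) →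
          f *ₚ descending h (q ℕ.+ 1) ≈ₚ X ^ₚ (q ℕ.+ 2) -ₚ C c *ₚ X
    in
    Irreducible f →
    f ∣ₚ (X ^ₚ (q ℕ.+ 1) -ₚ C c) ×
    (∃[ h ] IsH h) ×
    (∀ (h : ℕ → Carrier) → IsH h →
      h (q ℕ.+ 1) ≈ 0# ×
      (∃[ r ] (
        IsLeast (λ i → 2 ≤ i × i ≤ q ℕ.+ 1 × h i ≈ 0#) r ×
        IsBinomialOrder f r ×
        IsMinimalBinomialMultiple f r (- c * h (r ∸ 1)) ×
        (∃[ m ] (
          IsMultiplicativeOrder (- c * h (r ∸ 1)) m ×
          IsPolynomialOrder f (r ℕ.* m))))))
-- The rewriting turns q + 1 and q + 2 into successors, the form in which powers and coefficient
-- lists compute.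
theorem6p1 F q _ card b c irreducible rewrite ℕ.+-comm q 1 | ℕ.+-comm q 2 =
  f∣X^[1+q]-c irreducible ,
  (α-coefficient , isH-α-coefficient irreducible) ,
  λ h isH →
    let r , r-least = leastZeroIndex irreducible
        h≈s = isH-unique irreducible h isH
        α^r≈λ = α^r≈-ch[r-1] irreducible r-least h h≈s
        λ-order = multiplicativeOrder irreducible r-least α^r≈λ
    in trans (h≈s (s≤s z≤n) ℕ.≤-refl) (s[1+q]≈0 irreducible) ,
       r , leastZeroIndex-h irreducible r-least h h≈s ,
       (_ , minimalBinomialMultiple irreducible r-least α^r≈λ) ,
       minimalBinomialMultiple irreducible r-least α^r≈λ ,
       proj₁ λ-order , proj₂ λ-order , polynomialOrder irreducible r-least α^r≈λ (proj₂ λ-order)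
  where
  open HeytingField F using (trans)
  open IrreducibleQuadratic F q card b c
  open QuadraticEvaluation (HeytingCommutativeRing.commutativeRing (HeytingField.heytingCommutativeRing F)) b c
    using (α-coefficient)
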